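{- Let $G$ be a finite group. Then $G$ is a non-cyclic group of prime exponent if and only if the power graph $\mathcal{G}(G)$ is non-complete and minimally edge-connected.
   Context: The power graph $\mathcal{G}(G)$ of a group $G$ is the simple undirected graph with vertex set $G$ in which two distinct vertices $u,v$ are adjacent if and only if $v=u^n$ for some positive integer $n$ or $u=v^m$ for some positive integer $m$. For a graph $\Gamma$, $\kappa'(\Gamma)$ denotes its edge-connectivity (minimum number of edges whose removal disconnects $\Gamma$). A non-trivial connected graph $\Gamma$ is minimally edge-connected if $\kappa'(\Gamma-\varepsilon)=\kappa'(\Gamma)-1$ for every edge $\varepsilon$ of $\Gamma$. A group has prime exponent if there is a prime $p$ with $x^p=e$ for all $x\in G$. -}

module Defs where

open import Data.Nat using (ℕ; zero; suc; _∸_; _≥_; _<_)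
open import Data.Nat.Primality using (Prime)
open import Data.Fin using (Fin)
open import Data.Product using (Σ; ∃; ∃-syntax; _×_; _,_)
open import Data.Sum using (_⊎_)
open import Data.List using (List; length)
open import Data.List.Membership.Propositional using (_∈_)
open import Relation.Nullary using (¬_)
open import Relation.Binary.PropositionalEquality using (_≡_; _≢_)
open import Relation.Binary.Construct.Closure.ReflexiveTransitive using (Star)
open import Algebra.Structures using (IsGroup)

-- Finite groups: a group structure (with propositional equality) on
-- the carrier Fin n.  Every finite group is isomorphic to one of these.

record FiniteGroup : Set₁ where
  field
    n       : ℕ
    _∙_     : Fin n → Fin n → Fin n
    ε       : Fin n
    _⁻¹     : Fin n → Fin n
    isGroup : IsGroup _≡_ _∙_ ε _⁻¹

  Carrier : Set
  Carrier = Fin n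

  _^_ : Carrier → ℕ → Carrier
  x ^ zero  = ε
  x ^ suc k = x ∙ (x ^ k)

Elem : FiniteGroup → Set
Elem G = Fin (FiniteGroup.n G)

IsCyclic : FiniteGroup → Set
IsCyclic G = ∃[ g ] ∀ (x : Elem G) → ∃[ k ] x ≡ (g ^ k)
  where open FiniteGroup G

HasPrimeExponent : FiniteGroup → Set
HasPrimeExponent G = ∃[ p ] (Prime p × (∀ (x : Elem G) → (x ^ p) ≡ ε))
  where open FiniteGroup G

record Graph : Set₁ where
  field
    V     : ℕ
    Adj   : Fin V → Fin V → Set
    sym   : ∀ {u v} → Adj u v → Adj v u
    irrefl : ∀ {u} → ¬ Adj u u

open Graph public

Connected : Graph → Set
Connected Γ = ∀ (u v : Fin (V Γ)) → Star (Adj Γ) u v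

Complete : Graph → Set
Complete Γ = ∀ (u v : Fin (V Γ)) → u ≢ v → Adj Γ u v

deleteEdges : (Γ : Graph) → List (Fin (V Γ) × Fin (V Γ)) → Graph
deleteEdges Γ F = record
  { V      = V Γ
  ; Adj    = λ u v → Adj Γ u v × ¬ ((u , v) ∈ F) × ¬ ((v , u) ∈ F)
  ; sym    = λ { (a , b , c) → sym Γ a , c , b }
  ; irrefl = λ { (a , _ , _) → irrefl Γ a }
  }

deleteEdge : (Γ : Graph) → Fin (V Γ) → Fin (V Γ) → Graph
deleteEdge Γ a b = deleteEdges Γ ((a , b) Data.List.∷ Data.List.[])

Disconnecting : (Γ : Graph) → List (Fin (V Γ) × Fin (V Γ)) → Set
Disconnecting Γ F = ¬ Connected (deleteEdges Γ F)

-- κ'(Γ) = k : k is the minimum number of edges whose removal disconnects Γ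
-- (for a graph with at most one vertex, κ' = 0 by convention).
EdgeConnectivity : Graph → ℕ → Set
EdgeConnectivity Γ k =
  (V Γ < 2 × k ≡ 0) ⊎
  (V Γ ≥ 2 × (∃[ F ] (length F ≡ k × Disconnecting Γ F))
           × (∀ F → Disconnecting Γ F → length F ≥ k))

MinimallyEdgeConnected : Graph → Set
MinimallyEdgeConnected Γ =
  V Γ ≥ 2 × Connected Γ ×
  (∀ (a b : Fin (V Γ)) → Adj Γ a b →
     ∀ k → EdgeConnectivity Γ k → EdgeConnectivity (deleteEdge Γ a b) (k ∸ 1))

PowAdj : (G : FiniteGroup) → Elem G → Elem G → Set
PowAdj G u v =
  u ≢ v × ((∃[ k ] (0 < k × v ≡ (u ^ k))) ⊎ (∃[ m ] (0 < m × u ≡ (v ^ m))))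
  where open FiniteGroup G

powerGraph : FiniteGroup → Graph
powerGraph G = record
  { V      = FiniteGroup.n G
  ; Adj    = PowAdj G
  ; sym    = λ { (ne , Data.Sum.inj₁ p) → (λ e → ne (Relation.Binary.PropositionalEquality.sym e)) , Data.Sum.inj₂ p
               ; (ne , Data.Sum.inj₂ p) → (λ e → ne (Relation.Binary.PropositionalEquality.sym e)) , Data.Sum.inj₁ p }
  ; irrefl = λ { (ne , _) → ne Relation.Binary.PropositionalEquality.refl }
  }

{-# OPTIONS --safe #-}
module Submission where

-- Power graphs have the dominating vertex ε, and a cut-counting argument shows that the
-- edge-connectivity equals the minimum degree δ, even after deleting one edge at ε provided
-- all degrees stay at least δ.  In a non-cyclic group of prime exponent p every x ≠ ε has
-- degree p − 1, so deleting any edge lowers the edge-connectivity.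
--
-- Conversely, criticality of the edges {x, ε} forces every x ≠ ε to have degree δ, and then all
-- maximal cyclic subgroups have order m = δ + 1.  If two primes p ≠ q divided m, counting the
-- elements above one of order q modulo p would give p ∣ m − 1.  So m = pᵃ, and the maximal
-- cyclic subgroups meet trivially.  If S = {y | yᵖ ≠ ε} were non-empty, each y ∈ S would have a
-- maximal cyclic subgroup as centralizer, so S would be a union of conjugacy classes of size
-- k = |G| / m; as |S| (m − 1) = c (|G| − 1) with 1 ≤ c ≤ m − 1, this forces k = 1, so that |G| = m
-- and the power graph is complete.

open import Defs hiding (sym)
open import Algebra.Bundles using (Group)
import Algebra.Properties.Group as GroupProperties
open import Algebra.Structures using (IsGroup)
open import Data.Bool using (if_then_else_)
open import Data.Empty using (⊥-elim)
open import Data.Fin using (Fin; zero; suc; toℕ; fromℕ<)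
open import Data.Fin.Properties using (_≟_; any?; pigeonhole; toℕ-injective; toℕ<n; toℕ-fromℕ<)
open import Data.List using (List; []; _∷_; length; map; filter; allFin; tabulate)
open import Data.List.Properties using (length-map)
import Data.List.Membership.DecPropositional as DecMembership
open import Data.List.Membership.Propositional using (_∈_; find)
open import Data.List.Membership.Propositional.Properties using (∈-map⁺; ∈-filter⁺; ∈-allFin)
open import Data.List.Relation.Unary.All as All using (All; []; _∷_)
open import Data.List.Relation.Unary.All.Properties using (¬All⇒Any¬)
open import Data.List.Relation.Unary.Any using (here; there)
open import Data.Nat using (ℕ; zero; suc; _+_; _*_; _∸_; _≤_; _<_; z≤n; s≤s; NonZero; >-nonZero; nonTrivial⇒n>1)
import Data.Nat as ℕ
open import Data.Nat.Coprimality using (Coprime; prime⇒coprime; coprime-Bézout; coprime⇒gcd≡1; gcd≡1⇒coprime; coprime-divisor) renaming (sym to coprime-sym)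
open import Data.Nat.Divisibility
open import Data.Nat.DivMod using (_%_; _/_; m%n<n; m≡m%n+[m/n]*n)
open import Data.Nat.GCD using (gcd; gcd-GCD; gcd[m,n]∣m; gcd[m,n]∣n; module Bézout)
open import Data.Nat.GeneralisedArithmetic using (fold; fold-+)
open import Data.Nat.ListAction using (product)
open import Data.Nat.ListAction.Properties using (∈⇒∣product)
open import Data.Nat.Primality using (Prime; prime⇒nonZero; prime⇒nonTrivial; prime⇒irreducible; ¬prime[1]; ¬prime[0])
open import Data.Nat.Primality.Factorisation using (factorise)
open import Data.Nat.Properties hiding (_≟_)
import Data.Nat.Properties as ℕ
open import Algebra.Properties.Semiring.Sum +-*-semiring using (sum; ∑-comm; ∑-distrib-+; *-distribʳ-sum; sum-cong-≗; sum-replicate-zero)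
open import Data.Product using (∃-syntax; _×_; _,_; proj₁; proj₂; uncurry)
open import Data.Product.Properties using (≡-dec)
open import Data.Sum using (_⊎_; inj₁; inj₂; [_,_]′; swap)
open import Data.Unit using (⊤; tt)
open import Function using (_∘_; id; case_of_)
open import Function.Bundles using (_⇔_; mk⇔)
open import Level using (0ℓ)
open import Relation.Binary.Construct.Closure.ReflexiveTransitive using (Star; _◅_; _◅◅_; reverse) renaming (ε to ε⋆; map to map⋆)
open import Relation.Binary.Definitions using (tri<; tri≈; tri>)
open import Relation.Binary.PropositionalEquality using (_≡_; _≢_; refl; sym; trans; cong; cong₂; subst; module ≡-Reasoning)
open import Relation.Nullary using (¬_; Dec; yes; no; does; contradiction; ¬?; _×-dec_; _⊎-dec_)
open import Relation.Nullary.Decidable using (map′; decidable-stable; ¬¬-excluded-middle)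
open import Relation.Unary using (Decidable)

private variable
  a b n : ℕ
  A B : Set
  P Q : Fin n → Set

-- Counting in finite sets

ind : Dec A → ℕ
ind d = if does d then 1 else 0

ind-yes : (d : Dec A) → A → ind d ≡ 1
ind-yes (yes _) _ = refl
ind-yes (no ¬x) x = contradiction x ¬x

ind-no : (d : Dec A) → ¬ A → ind d ≡ 0
ind-no (yes x) ¬x = contradiction x ¬x
ind-no (no _) _ = refl

ind-mono : (c : Dec A) (d : Dec B) → (A → B) → ind c ≤ ind d
ind-mono (yes x) d f = ≤-reflexive (sym (ind-yes d (f x)))
ind-mono (no _)  d f = z≤n

sum-mono : {f g : Fin n → ℕ} → (∀ i → f i ≤ g i) → sum f ≤ sum g
sum-mono {zero}  h = z≤n
sum-mono {suc n} h = +-mono-≤ (h zero) (sum-mono (h ∘ suc))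

count : {P : Fin n → Set} → Decidable P → ℕ
count P? = sum (λ i → ind (P? i))

count-mono : (P? : Decidable P) (Q? : Decidable Q) → (∀ i → P i → Q i) → count P? ≤ count Q?
count-mono P? Q? h = sum-mono (λ i → ind-mono (P? i) (Q? i) (h i))

count-cong : (P? : Decidable P) (Q? : Decidable Q) →
  (∀ i → P i → Q i) → (∀ i → Q i → P i) → count P? ≡ count Q?
count-cong P? Q? f g = ≤-antisym (count-mono P? Q? f) (count-mono Q? P? g)

count-none : (P? : Decidable {A = Fin n} P) → (∀ i → ¬ P i) → count P? ≡ 0
count-none {n = zero}  P? h = refl
count-none {n = suc n} P? h = cong₂ _+_ (ind-no (P? zero) (h zero)) (count-none (P? ∘ suc) (h ∘ suc))

count-all : (P? : Decidable {A = Fin n} P) → (∀ i → P i) → count P? ≡ n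
count-all {n = zero}  P? h = refl
count-all {n = suc n} P? h = cong₂ _+_ (ind-yes (P? zero) (h zero)) (count-all (P? ∘ suc) (h ∘ suc))

count-≡ : (x : Fin n) → count (x ≟_) ≡ 1
count-≡ {n = suc n} zero = cong suc (count-none {n = n} (λ i → zero ≟ suc i) (λ _ ()))
count-≡ {n = suc n} (suc x) = trans
  (count-cong (λ i → suc x ≟ suc i) (x ≟_) (λ { _ refl → refl }) (λ { _ refl → refl }))
  (count-≡ x)

count-unique : (P? : Decidable {A = Fin n} P) (x : Fin n) → P x → (∀ y → P y → x ≡ y) → count P? ≡ 1
count-unique P? x px h = trans (count-cong P? (x ≟_) h (λ { _ refl → px })) (count-≡ x)

count-split : (P? : Decidable P) (Q? : Decidable Q) →
  count P? ≡ count (λ i → P? i ×-dec Q? i) + count (λ i → P? i ×-dec ¬? (Q? i))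
count-split P? Q? = trans
  (sum-cong-≗ (λ i → split (P? i) (Q? i)))
  (∑-distrib-+ (λ i → ind (P? i ×-dec Q? i)) (λ i → ind (P? i ×-dec ¬? (Q? i))))
  where
  split : (c : Dec A) (d : Dec B) → ind c ≡ ind (c ×-dec d) + ind (c ×-dec ¬? d)
  split (yes _) (yes _) = refl
  split (yes _) (no _)  = refl
  split (no _)  _       = refl

count-remove : (P? : Decidable P) (x : Fin n) → P x →
  count P? ≡ suc (count (λ i → P? i ×-dec ¬? (x ≟ i)))
count-remove P? x px = trans (count-split P? (x ≟_))
  (cong (_+ count (λ i → P? i ×-dec ¬? (x ≟ i))) (count-unique (λ i → P? i ×-dec (x ≟ i)) x (px , refl) (λ _ → proj₂)))

count-pos : (P? : Decidable P) (x : Fin n) → P x → 1 ≤ count P?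
count-pos P? x px = subst (1 ≤_) (sym (count-remove P? x px)) (s≤s z≤n)

-- An element of `Q` missing from `P` would leave `P` inside `Q` with that element removed, which is
-- strictly smaller.
⊆∧count≥⇒⊇ : (P? : Decidable {A = Fin n} P) (Q? : Decidable Q) → (∀ i → P i → Q i) →
  count Q? ≤ count P? → ∀ i → Q i → P i
⊆∧count≥⇒⊇ P? Q? P⊆Q Q≤P i qi with P? i
... | yes pi = pi
... | no ¬pi = contradiction Q≤P (<⇒≱ (begin-strict
  count P?                              ≤⟨ count-mono P? (λ j → Q? j ×-dec ¬? (i ≟ j)) (λ j pj → P⊆Q j pj , λ { refl → ¬pi pj }) ⟩
  count (λ j → Q? j ×-dec ¬? (i ≟ j))   <⟨ ≤-refl ⟩
  suc (count (λ j → Q? j ×-dec ¬? (i ≟ j))) ≡⟨ count-remove Q? i qi ⟨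
  count Q?                              ∎))
  where open ≤-Reasoning

-- Both sides are the number of pairs in `T`: by `T⊆`, rows outside `P` and columns outside `Q` are
-- empty.
double-count : {T : Fin a → Fin b → Set} (P? : Decidable P) (Q? : Decidable Q)
  (T? : ∀ i j → Dec (T i j)) (s t : ℕ) → (∀ i j → T i j → P i × Q j) →
  (∀ i → P i → count (T? i) ≡ s) → (∀ j → Q j → count (λ i → T? i j) ≡ t) →
  count P? * s ≡ count Q? * t
double-count P? Q? T? s t T⊆ rows cols = begin
  count P? * s                          ≡⟨ weigh P? T? s (λ i ¬p j → ¬p ∘ proj₁ ∘ T⊆ i j) rows ⟩
  sum (λ i → sum (λ j → ind (T? i j)))  ≡⟨ ∑-comm (λ i j → ind (T? i j)) ⟩
  sum (λ j → sum (λ i → ind (T? i j)))  ≡⟨ weigh Q? (λ j i → T? i j) t (λ j ¬q i → ¬q ∘ proj₂ ∘ T⊆ i j) cols ⟨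
  count Q? * t                          ∎
  where
  open ≡-Reasoning
  weigh : ∀ {a b} {P : Fin a → Set} {T : Fin a → Fin b → Set} (P? : Decidable P) (T? : ∀ i j → Dec (T i j)) s →
    (∀ i → ¬ P i → ∀ j → ¬ T i j) → (∀ i → P i → count (T? i) ≡ s) →
    count P? * s ≡ sum (λ i → count (T? i))
  weigh P? T? s off on = trans (*-distribʳ-sum s (λ i → ind (P? i))) (sum-cong-≗ λ i → row i (P? i))
    where
    row : ∀ i d → ind d * s ≡ count (T? i)
    row i (yes p) = trans (+-identityʳ s) (sym (on i p))
    row i (no ¬p) = sym (count-none (T? i) (off i ¬p))

count-bijection : (P? : Decidable {A = Fin a} P) (Q? : Decidable {A = Fin b} Q) (f : Fin a → Fin b) →
  (∀ i → P i → Q (f i)) → (∀ i j → P i → P j → f i ≡ f j → i ≡ j) →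
  (∀ j → Q j → ∃[ i ] (P i × f i ≡ j)) → count P? ≡ count Q?
count-bijection P? Q? f to inj surj = trans (sym (*-identityʳ _)) (trans
  (double-count P? Q? (λ i j → P? i ×-dec (f i ≟ j)) 1 1
    (λ { i j (p , refl) → p , to i p })
    (λ i p → count-unique (λ j → P? i ×-dec (f i ≟ j)) (f i) (p , refl) (λ _ → proj₂))
    (λ j q → let i , p , e = surj j q in
      count-unique (λ i → P? i ×-dec (f i ≟ j)) i (p , e) (λ i′ (p′ , e′) → inj i i′ p p′ (trans e (sym e′)))))
  (*-identityʳ _))

-- Splits off the class of one element of `P` and recurses on the rest, whose size `fuel` bounds.
-- Reflexivity and the Euclidean law together make `R` an equivalence.
classes-∣ : {R : Fin n → Fin n → Set} (R? : ∀ x y → Dec (R x y)) →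
  (∀ x → R x x) → (∀ {x y z} → R x y → R z y → R x z) → ∀ k (P? : Decidable P) →
  (∀ x y → P x → R x y → P y) → (∀ x → P x → count (R? x) ≡ k) → k ∣ count P?
classes-∣ {n = n} {R = R} R? R-refl R-euclid k P? closed size = go (count P?) P? ≤-refl closed size
  where
  go : ∀ fuel {P : Fin n → Set} (P? : Decidable P) → count P? ≤ fuel →
    (∀ x y → P x → R x y → P y) → (∀ x → P x → count (R? x) ≡ k) → k ∣ count P?
  go zero P? le _ _ = subst (k ∣_) (sym (n≤0⇒n≡0 le)) (k ∣0)
  go (suc fuel) {P} P? le closed size with any? P?
  ... | no ¬∃ = subst (k ∣_) (sym (count-none P? (λ i p → ¬∃ (i , p)))) (k ∣0)
  ... | yes (x , px) = subst (k ∣_) (sym (count-split P? (R? x))) (∣m∣n⇒∣m+n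
      (subst (k ∣_) (sym (trans class (size x px))) ∣-refl)
      (go fuel P′? (≤-pred (≤-trans smaller le))
        (λ y z (py , ¬xy) yz → closed y z py yz , λ xz → ¬xy (R-euclid xz yz))
        (λ y → size y ∘ proj₁)))
    where
    P′? = λ y → P? y ×-dec ¬? (R? x y)
    class : count (λ y → P? y ×-dec R? x y) ≡ count (R? x)
    class = count-cong (λ y → P? y ×-dec R? x y) (R? x) (λ _ → proj₂) (λ y r → closed x y px r , r)
    smaller : suc (count P′?) ≤ count P?
    smaller = subst (suc (count P′?) ≤_) (sym (count-split P? (R? x)))
      (+-monoˡ-≤ (count P′?) (count-pos (λ y → P? y ×-dec R? x y) x (px , R-refl x)))

count-≤-remove : (P? : Decidable {A = Fin n} P) (x : Fin n) →
  count P? ≤ suc (count (λ i → P? i ×-dec ¬? (x ≟ i)))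
count-≤-remove P? x = ≤-trans (≤-reflexive (count-split P? (x ≟_)))
  (+-monoˡ-≤ _ (≤-trans (count-mono (λ i → P? i ×-dec (x ≟ i)) (x ≟_) (λ _ → proj₂)) (≤-reflexive (count-≡ x))))

least : {P : ℕ → Set} → Decidable P → ∀ N → P N → ∃[ d ] (P d × ∀ k → P k → d ≤ k)
least {P} P? N pN = go (suc N) N ≤-refl pN
  where
  go : ∀ fuel N → N < fuel → P N → ∃[ d ] (P d × ∀ k → P k → d ≤ k)
  go (suc fuel) N (s≤s N≤fuel) pN with anyUpTo? P? N
  ... | yes (k , k<N , pk) = go fuel k (<-≤-trans k<N N≤fuel) pk
  ... | no none = N , pN , λ k pk → ≮⇒≥ (λ k<N → none (k , k<N , pk))

-- Edge cuts of graphs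

length-filter-tabulate : {P : A → Set} (P? : Decidable P) (f : Fin n → A) →
  length (filter P? (tabulate f)) ≡ count (λ i → P? (f i))
length-filter-tabulate {n = zero}  P? f = refl
length-filter-tabulate {n = suc n} P? f with P? (f zero)
... | yes _ = cong suc (length-filter-tabulate P? (f ∘ suc))
... | no _  = length-filter-tabulate P? (f ∘ suc)

-- Induction on `L`: the head `(c , d)` accounts for at most one pair of `X`, and only in row `c`;
-- the other pairs are covered by the tail.
∑-count-≤-length : {X : Fin n → Fin n → Set} (X? : ∀ u v → Dec (X u v)) (L : List (Fin n × Fin n)) →
  (∀ u v → X u v → (u , v) ∈ L) → sum (λ u → count (X? u)) ≤ length L
∑-count-≤-length {n = n} X? [] cover = ≤-reflexive (trans
  (sum-cong-≗ λ u → count-none (X? u) (λ v x → case cover u v x of λ ()))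
  (sum-replicate-zero n))
∑-count-≤-length {n = n} {X = X} X? ((c , d) ∷ L) cover = begin
  sum (λ u → count (X? u))                               ≤⟨ sum-mono row ⟩
  sum (λ u → ind (c ≟ u) + count (X′? u))                ≡⟨ ∑-distrib-+ (λ u → ind (c ≟ u)) (λ u → count (X′? u)) ⟩
  count (c ≟_) + sum (λ u → count (X′? u))               ≤⟨ +-mono-≤ (≤-reflexive (count-≡ c)) (∑-count-≤-length X′? L cover′) ⟩
  suc (length L)                                         ∎
  where
  open ≤-Reasoning
  at? : ∀ u v → Dec (c ≡ u × d ≡ v)
  at? u v = (c ≟ u) ×-dec (d ≟ v)
  X′? : ∀ u v → Dec (X u v × ¬ (c ≡ u × d ≡ v))
  X′? u v = X? u v ×-dec ¬? (at? u v)
  cover′ : ∀ u v → X u v × ¬ (c ≡ u × d ≡ v) → (u , v) ∈ L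
  cover′ u v (x , ne) with cover u v x
  ... | here refl = contradiction (refl , refl) ne
  ... | there u∈ = u∈
  first : ∀ u (e : Dec (c ≡ u)) → count (λ v → X? u v ×-dec at? u v) ≤ ind e
  first u (yes _) = ≤-trans (count-mono (λ v → X? u v ×-dec at? u v) (d ≟_) (λ _ → proj₂ ∘ proj₂))
                            (≤-reflexive (count-≡ d))
  first u (no c≢u) = ≤-reflexive (count-none (λ v → X? u v ×-dec at? u v) (λ _ → c≢u ∘ proj₁ ∘ proj₂))
  row : ∀ u → count (X? u) ≤ ind (c ≟ u) + count (X′? u)
  row u = ≤-trans (≤-reflexive (count-split (X? u) (at? u))) (+-monoˡ-≤ (count (X′? u)) (first u (c ≟ u)))

-- Reachability is needed below only on the way to a contradiction, so deciding it under a double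
-- negation is enough.
¬¬-decidable : (P : Fin n → Set) → ¬ ¬ (∀ i → Dec (P i))
¬¬-decidable {n = zero}  P k = k λ ()
¬¬-decidable {n = suc n} P k = ¬¬-excluded-middle λ d → ¬¬-decidable (P ∘ suc) λ ds →
  k λ { zero → d ; (suc i) → ds i }

-- Suppose `x < δ`. Then `s ≤ δ`, and with `t = δ ∸ s` the first bound reads `s + s * t ≤ x`,
-- against `x < δ = s + t ≤ s + s * t`.
cut-arithmetic : ∀ {δ x} s → 1 ≤ s → s * suc δ ≤ x + s * s → s ≤ suc x → δ ≤ x
cut-arithmetic {δ} {x} s@(suc _) 1≤s big small with δ ≤? x
... | yes δ≤x = δ≤x
... | no δ≰x = contradiction (+-cancelʳ-≤ (s * s) (s + s * t) x (begin
    s + s * t + s * s    ≡⟨ +-assoc s (s * t) (s * s) ⟩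
    s + (s * t + s * s)  ≡⟨ cong (s +_) (*-distribˡ-+ s t s) ⟨
    s + s * (t + s)      ≡⟨ cong (λ z → s + s * z) (m∸n+n≡m s≤δ) ⟩
    s + s * δ            ≡⟨ *-suc s δ ⟨
    s * suc δ            ≤⟨ big ⟩
    x + s * s            ∎))
  (<⇒≱ (begin-strict
    x          <⟨ ≰⇒> δ≰x ⟩
    δ          ≡⟨ m+[n∸m]≡n s≤δ ⟨
    s + t      ≤⟨ +-monoʳ-≤ s (m≤n*m t s) ⟩
    s + s * t  ∎))
  where
  open ≤-Reasoning
  t = δ ∸ s
  s≤δ : s ≤ δ
  s≤δ = ≤-trans small (≰⇒> δ≰x)

-- If F separates the set A of the s vertices that are not reachable from c, then each
-- vertex of A has at least δ + 1 − s neighbours outside A, and all but one of them have c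
-- as such a neighbour; so F has at least max (s (δ + 1 − s)) (s − 1) ≥ δ elements.
disconnecting-≥ : (Γ : Graph) (adj? : ∀ u v → Dec (Adj Γ u v)) (c w : Fin (V Γ)) (δ : ℕ) →
  (∀ v → v ≢ c → v ≢ w → Adj Γ v c) → (∀ v → δ ≤ count (adj? v)) →
  ∀ F → Disconnecting Γ F → δ ≤ length F
disconnecting-≥ Γ adj? c w δ dominating degree F disconnecting with δ ≤? length F
... | yes le = le
... | no ≰ = ⊥-elim (¬¬-decidable (Star (Adj H) c) λ reach? → disconnecting λ u v →
        reverse (Graph.sym H) (reached reach? u) ◅◅ reached reach? v)
  where
  H : Graph
  H = deleteEdges Γ F
  module _ (reach? : ∀ v → Dec (Star (Adj H) c v)) where
    A? : ∀ v → Dec (¬ Star (Adj H) c v)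
    A? v = ¬? (reach? v)
    X? : ∀ u v → Dec (¬ Star (Adj H) c u × Star (Adj H) c v × Adj Γ u v)
    X? u v = A? u ×-dec reach? v ×-dec adj? u v
    s : ℕ
    s = count A?
    -- `F` may list a cut edge in either direction. Putting the end separated from `c` first covers
    -- all cut edges by a list as long as `F`.
    orient : Fin (V Γ) × Fin (V Γ) → Fin (V Γ) × Fin (V Γ)
    orient (u , v) = if does (reach? u) then (v , u) else (u , v)
    orient-out : ∀ u v → ¬ Star (Adj H) c u → orient (u , v) ≡ (u , v)
    orient-out u v ¬r with reach? u
    ... | yes r = contradiction r ¬r
    ... | no _  = refl
    orient-in : ∀ u v → Star (Adj H) c v → orient (v , u) ≡ (u , v)
    orient-in u v r with reach? v
    ... | yes _ = refl
    ... | no ¬r = contradiction r ¬r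
    open DecMembership (≡-dec (_≟_ {V Γ}) (_≟_ {V Γ})) using (_∈?_)
    cover : ∀ u v → ¬ Star (Adj H) c u × Star (Adj H) c v × Adj Γ u v → (u , v) ∈ map orient F
    cover u v (¬ru , rv , uv) with (u , v) ∈? F | (v , u) ∈? F
    ... | yes uv∈ | _ = subst (_∈ map orient F) (orient-out u v ¬ru) (∈-map⁺ orient uv∈)
    ... | no _ | yes vu∈ = subst (_∈ map orient F) (orient-in u v rv) (∈-map⁺ orient vu∈)
    ... | no uv∉ | no vu∉ = contradiction (rv ◅◅ (Graph.sym Γ uv , vu∉ , uv∉) ◅ ε⋆) ¬ru
    x : Fin (V Γ) → ℕ
    x u = count (X? u)
    ∑x≤ : sum x ≤ length F
    ∑x≤ = ≤-trans (∑-count-≤-length X? (map orient F) cover) (≤-reflexive (length-map orient F))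
    degree-cut : ∀ u (d : Dec (¬ Star (Adj H) c u)) → ind d * suc δ ≤ x u + ind d * s
    degree-cut u (no _) = z≤n
    degree-cut u (yes ¬ru) = begin
      1 * suc δ                                    ≡⟨ *-identityˡ (suc δ) ⟩
      suc δ                                        ≤⟨ s≤s (degree u) ⟩
      suc (count (adj? u))                         ≡⟨ cong suc (count-split (adj? u) reach?) ⟩
      suc (count out? + count in?)                 ≤⟨ s≤s (+-mono-≤
                                                       (count-mono out? (X? u) (λ _ (uv , r) → ¬ru , r , uv))
                                                       (count-mono in? rest? λ { v (uv , ¬r) → ¬r , λ { refl → irrefl Γ uv } })) ⟩
      suc (x u + count rest?)                      ≡⟨ +-suc (x u) (count rest?) ⟨
      x u + suc (count rest?)                      ≡⟨ cong (x u +_) (count-remove A? u ¬ru) ⟨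
      x u + s                                      ≡⟨ cong (x u +_) (*-identityˡ s) ⟨
      x u + 1 * s                                  ∎
      where
      open ≤-Reasoning
      out? = λ v → adj? u v ×-dec reach? v
      in? = λ v → adj? u v ×-dec ¬? (reach? v)
      rest? = λ v → A? v ×-dec ¬? (u ≟ v)
    dominating-cut : ∀ u (d : Dec (¬ Star (Adj H) c u × w ≢ u)) → ind d ≤ x u
    dominating-cut u (no _) = z≤n
    dominating-cut u (yes (¬ru , w≢u)) = count-pos (X? u) c
      (¬ru , ε⋆ , dominating u (λ { refl → ¬ru ε⋆ }) (w≢u ∘ sym))
    cut-≥ : ∀ u → ¬ Star (Adj H) c u → δ ≤ length F
    cut-≥ u ¬ru = ≤-trans (cut-arithmetic s (count-pos A? u ¬ru)
      (begin
        s * suc δ                                  ≡⟨ *-distribʳ-sum (suc δ) (λ u → ind (A? u)) ⟩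
        sum (λ u → ind (A? u) * suc δ)             ≤⟨ sum-mono (λ u → degree-cut u (A? u)) ⟩
        sum (λ u → x u + ind (A? u) * s)           ≡⟨ ∑-distrib-+ x (λ u → ind (A? u) * s) ⟩
        sum x + sum (λ u → ind (A? u) * s)         ≡⟨ cong (sum x +_) (*-distribʳ-sum s (λ u → ind (A? u))) ⟨
        sum x + s * s                              ∎)
      (≤-trans (count-≤-remove A? w) (s≤s (sum-mono λ u → dominating-cut u (A? u ×-dec ¬? (w ≟ u))))))
      ∑x≤
      where open ≤-Reasoning
    reached : ∀ v → Star (Adj H) c v
    reached v with reach? v
    ... | yes r = r
    ... | no ¬r = contradiction (cut-≥ v ¬r) ≰

-- A path from `u` to another vertex has a first edge, and every edge at `u` is removed.
isolating-set : (Γ : Graph) (adj? : ∀ u v → Dec (Adj Γ u v)) {u v : Fin (V Γ)} → u ≢ v →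
  ∃[ F ] (length F ≡ count (adj? u) × Disconnecting Γ F)
isolating-set Γ adj? {u} {v} u≢v = F , length-F , λ connected → escape (connected u v)
  where
  F = map (u ,_) (filter (adj? u) (allFin (V Γ)))
  length-F : length F ≡ count (adj? u)
  length-F = trans (length-map (u ,_) (filter (adj? u) (allFin (V Γ)))) (length-filter-tabulate (adj? u) id)
  escape : ¬ Star (Adj (deleteEdges Γ F)) u v
  escape ε⋆ = u≢v refl
  escape (_◅_ {j = j} (uj , uj∉F , _) _) = uj∉F (∈-map⁺ (u ,_) (∈-filter⁺ (adj? u) (∈-allFin j) uj))

-- Degrees after deleting one edge

module _ (Γ : Graph) (adj? : ∀ u v → Dec (Adj Γ u v)) (a b : Fin (V Γ)) where
  open DecMembership (≡-dec (_≟_ {V Γ}) (_≟_ {V Γ})) using (_∈?_)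

  deleteEdge-adj? : ∀ u v → Dec (Adj (deleteEdge Γ a b) u v)
  deleteEdge-adj? u v = adj? u v ×-dec ¬? ((u , v) ∈? ((a , b) ∷ [])) ×-dec ¬? ((v , u) ∈? ((a , b) ∷ []))

  deleteEdge-degree-a : Adj Γ a b → suc (count (deleteEdge-adj? a)) ≤ count (adj? a)
  deleteEdge-degree-a ab = ≤-trans
    (s≤s (count-mono (deleteEdge-adj? a) (λ v → adj? a v ×-dec ¬? (b ≟ v))
      λ { v (av , av∉ , _) → av , λ { refl → av∉ (here refl) } }))
    (≤-reflexive (sym (count-remove (adj? a) b ab)))

  deleteEdge-degree-b : Adj Γ a b → suc (count (deleteEdge-adj? b)) ≤ count (adj? b)
  deleteEdge-degree-b ab = ≤-trans
    (s≤s (count-mono (deleteEdge-adj? b) (λ v → adj? b v ×-dec ¬? (a ≟ v))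
      λ { v (bv , _ , vb∉) → bv , λ { refl → vb∉ (here refl) } }))
    (≤-reflexive (sym (count-remove (adj? b) a (Graph.sym Γ ab))))

  -- An endpoint loses at most one neighbour and has one to spare; every other vertex loses none.
  deleteEdge-degree-≥ : ∀ δ → (∀ v → δ ≤ count (adj? v)) → δ < count (adj? a) → δ < count (adj? b) →
    ∀ v → δ ≤ count (deleteEdge-adj? v)
  deleteEdge-degree-≥ δ δ≤ δ<a δ<b v = go (a ≟ v) (b ≟ v)
    where
    pair : ∀ {x y : Fin (V Γ)} → (x , y) ∈ ((a , b) ∷ []) → x ≡ a × y ≡ b
    pair (here refl) = refl , refl
    go : Dec (a ≡ v) → Dec (b ≡ v) → δ ≤ count (deleteEdge-adj? v)
    go (yes refl) _ = ≤-pred (≤-trans δ<a (≤-trans (count-≤-remove (adj? a) b)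
      (s≤s (count-mono (λ v → adj? a v ×-dec ¬? (b ≟ v)) (deleteEdge-adj? a)
        λ v (av , b≢v) → av , (λ m → b≢v (sym (proj₂ (pair m))))
          , λ m → irrefl Γ (subst (Adj Γ a) (proj₁ (pair m)) av)))))
    go _ (yes refl) = ≤-pred (≤-trans δ<b (≤-trans (count-≤-remove (adj? b) a)
      (s≤s (count-mono (λ v → adj? b v ×-dec ¬? (a ≟ v)) (deleteEdge-adj? b)
        λ v (bv , a≢v) → bv , (λ m → irrefl Γ (subst (Adj Γ b) (proj₂ (pair m)) bv))
          , λ m → a≢v (sym (proj₁ (pair m)))))))
    go (no a≢v) (no b≢v) = ≤-trans (δ≤ v) (count-mono (adj? v) (deleteEdge-adj? v)
      λ _ vu → vu , (λ m → a≢v (sym (proj₁ (pair m)))) , λ m → b≢v (sym (proj₂ (pair m))))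

-- Free actions of cyclic groups of prime order

module _ {σ : A → A} {x : A} where
  fold-period : ∀ {d} → fold x σ d ≡ x → ∀ k → fold x σ (k * d) ≡ x
  fold-period {d} e zero    = refl
  fold-period {d} e (suc k) = trans (fold-+ x σ d) (trans (cong (λ z → fold z σ d) (fold-period e k)) e)

  -- By Bézout, a multiple of `d` and a multiple of `p` differ by one. Both numbers of steps fix
  -- `x`, hence so does the one step between them.
  fold-coprime : ∀ {d p} → Coprime d p → fold x σ d ≡ x → fold x σ p ≡ x → σ x ≡ x
  fold-coprime {d} {p} coprime ed ep with coprime-Bézout coprime
  ... | Bézout.+- i j eq = trans (cong σ (sym (fold-period ep j))) (trans (cong (fold x σ) eq) (fold-period ed i))
  ... | Bézout.-+ i j eq = trans (cong σ (sym (fold-period ed i))) (trans (cong (fold x σ) eq) (fold-period ep j))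

module FreeAction (σ : Fin n → Fin n) (r : ℕ) (prime : Prime (suc r)) (σᵖ : ∀ y → fold y σ (suc r) ≡ y) where
  private
    p : ℕ
    p = suc r

  -- With `p = suc r`, `r` further steps complete a period, so iterating `σ` also provides its
  -- inverse.
  shift-back : ∀ x j → fold (fold x σ j) σ (r * j) ≡ x
  shift-back x j = begin
    fold (fold x σ j) σ (r * j)  ≡⟨ fold-+ x σ (r * j) ⟨
    fold x σ (r * j + j)         ≡⟨ cong (fold x σ) (trans (+-comm (r * j) j) (*-comm p j)) ⟩
    fold x σ (j * p)             ≡⟨ fold-period (σᵖ x) j ⟩
    x                            ∎
    where open ≡-Reasoning

  _≈_ : Fin n → Fin n → Set
  x ≈ y = ∃[ i ] fold x σ i ≡ y

  reduce : ∀ x i → fold x σ i ≡ fold x σ (i % p)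
  reduce x i = begin
    fold x σ i                                ≡⟨ cong (fold x σ) (m≡m%n+[m/n]*n i p) ⟩
    fold x σ (i % p + i / p * p)              ≡⟨ fold-+ x σ (i % p) ⟩
    fold (fold x σ (i / p * p)) σ (i % p)     ≡⟨ cong (λ z → fold z σ (i % p)) (fold-period (σᵖ x) (i / p)) ⟩
    fold x σ (i % p)                          ∎
    where open ≡-Reasoning

  index : ∀ {x y} → x ≈ y → ∃[ i ] fold x σ (toℕ {p} i) ≡ y
  index {x} (i , e) = fromℕ< (m%n<n i p) ,
    trans (cong (fold x σ) (toℕ-fromℕ< (m%n<n i p))) (trans (sym (reduce x i)) e)

  _≈?_ : ∀ x y → Dec (x ≈ y)
  x ≈? y = map′ (λ (i , e) → toℕ i , e) index (any? (λ i → fold x σ (toℕ {p} i) ≟ y))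

  ≈-euclidean : ∀ {x y z} → x ≈ y → z ≈ y → x ≈ z
  ≈-euclidean {x} {y} {z} (i , xy) (j , zy) = r * j + i , (begin
    fold x σ (r * j + i)         ≡⟨ fold-+ x σ (r * j) ⟩
    fold (fold x σ i) σ (r * j)  ≡⟨ cong (λ w → fold w σ (r * j)) (trans xy (sym zy)) ⟩
    fold (fold z σ j) σ (r * j)  ≡⟨ shift-back z j ⟩
    z                            ∎)
    where open ≡-Reasoning

  -- Undoing `i` steps on both sides gives the period `j ∸ i`, which is coprime to `p` because it
  -- lies strictly between 0 and `p`; then `σ` would fix `x`.
  no-collision : ∀ x → σ x ≢ x → ∀ {i j} → i < j → j < p → fold x σ i ≢ fold x σ j
  no-collision x σx≢x {i} {j} i<j j<p e = σx≢x (fold-coprime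
    (coprime-sym (prime⇒coprime prime {{>-nonZero (m<n⇒0<n∸m i<j)}} (≤-<-trans (m∸n≤m j i) j<p)))
    (begin
      fold x σ (j ∸ i)                        ≡⟨ shift-back (fold x σ (j ∸ i)) i ⟨
      fold (fold (fold x σ (j ∸ i)) σ i) σ (r * i) ≡⟨ cong (λ z → fold z σ (r * i)) (fold-+ x σ i) ⟨
      fold (fold x σ (i + (j ∸ i))) σ (r * i) ≡⟨ cong (λ k → fold (fold x σ k) σ (r * i)) (m+[n∸m]≡n (<⇒≤ i<j)) ⟩
      fold (fold x σ j) σ (r * i)             ≡⟨ cong (λ z → fold z σ (r * i)) e ⟨
      fold (fold x σ i) σ (r * i)             ≡⟨ shift-back x i ⟩
      x                                       ∎)
    (σᵖ x))
    where open ≡-Reasoning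

  -- The first `p` iterates are pairwise distinct and, after reducing exponents modulo `p`, exhaust
  -- the orbit.
  orbit-size : ∀ x → σ x ≢ x → count (x ≈?_) ≡ p
  orbit-size x σx≢x = trans
    (sym (count-bijection {P = λ _ → ⊤} (λ (_ : Fin p) → yes tt) (x ≈?_) (λ i → fold x σ (toℕ i))
      (λ i _ → toℕ i , refl)
      (λ i j _ _ e → inj i j e)
      (λ y r → let i , e = index r in i , tt , e)))
    (count-all {P = λ _ → ⊤} (λ (_ : Fin p) → yes tt) (λ _ → tt))
    where
    inj : ∀ (i j : Fin p) → fold x σ (toℕ i) ≡ fold x σ (toℕ j) → i ≡ j
    inj i j e with ℕ.<-cmp (toℕ i) (toℕ j)
    ... | tri< i<j _ _ = contradiction e (no-collision x σx≢x i<j (toℕ<n j))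
    ... | tri≈ _ i≡j _ = toℕ-injective i≡j
    ... | tri> _ _ j<i = contradiction (sym e) (no-collision x σx≢x j<i (toℕ<n i))

  count-∣ : (P? : Decidable P) → (∀ y → P y → P (σ y)) → (∀ y → P y → σ y ≢ y) → p ∣ count P?
  count-∣ {P = P} P? closed free = classes-∣ _≈?_ (λ _ → 0 , refl) ≈-euclidean p P? closed* (λ x px → orbit-size x (free x px))
    where
    closed* : ∀ x y → P x → x ≈ y → P y
    closed* x y px (zero , refl) = px
    closed* x y px (suc i , refl) = closed _ (closed* x _ px (i , refl))

-- Orders, cyclic subgroups and conjugation

module GroupTheory (G : FiniteGroup) where
  open FiniteGroup G public renaming (n to |G|)
  open IsGroup isGroup public using (assoc; identityˡ; identityʳ; inverseˡ; inverseʳ)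

  group : Group 0ℓ 0ℓ
  group = record { isGroup = isGroup }

  open GroupProperties group public using (∙-cancelˡ; ∙-cancelʳ; ⁻¹-anti-homo-∙; inverseʳ-unique; inverseˡ-unique; ε⁻¹≈ε)

  ^-+ : ∀ x i j → x ^ (i + j) ≡ (x ^ i) ∙ (x ^ j)
  ^-+ x zero    j = sym (identityˡ _)
  ^-+ x (suc i) j = trans (cong (x ∙_) (^-+ x i j)) (sym (assoc _ _ _))

  ^-* : ∀ x i j → x ^ (i * j) ≡ (x ^ j) ^ i
  ^-* x zero    j = refl
  ^-* x (suc i) j = trans (^-+ x j (i * j)) (cong ((x ^ j) ∙_) (^-* x i j))

  ε^ : ∀ k → ε ^ k ≡ ε
  ε^ zero    = refl
  ε^ (suc k) = trans (identityˡ _) (ε^ k)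

  ^1 : ∀ x → x ^ 1 ≡ x
  ^1 = identityʳ

  ^-*-ε : ∀ x i j → x ^ j ≡ ε → x ^ (i * j) ≡ ε
  ^-*-ε x i j e = trans (^-* x i j) (trans (cong (_^ i) e) (ε^ i))

  ∣⇒^≡ε : ∀ x {i j} → x ^ i ≡ ε → i ∣ j → x ^ j ≡ ε
  ∣⇒^≡ε x e (divides q refl) = ^-*-ε x q _ e

  Commute : Carrier → Carrier → Set
  Commute x y = x ∙ y ≡ y ∙ x

  commute-^ : ∀ {x y} → Commute x y → ∀ k → Commute x (y ^ k)
  commute-^ {x} {y} c zero    = trans (identityʳ x) (sym (identityˡ x))
  commute-^ {x} {y} c (suc k) = begin
    x ∙ (y ∙ (y ^ k))  ≡⟨ assoc x y (y ^ k) ⟨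
    (x ∙ y) ∙ (y ^ k)  ≡⟨ cong (_∙ (y ^ k)) c ⟩
    (y ∙ x) ∙ (y ^ k)  ≡⟨ assoc y x (y ^ k) ⟩
    y ∙ (x ∙ (y ^ k))  ≡⟨ cong (y ∙_) (commute-^ c k) ⟩
    y ∙ ((y ^ k) ∙ x)  ≡⟨ assoc y (y ^ k) x ⟨
    (y ∙ (y ^ k)) ∙ x  ∎
    where open ≡-Reasoning

  powers-commute : ∀ x i j → Commute (x ^ i) (x ^ j)
  powers-commute x i j = commute-^ (sym (commute-^ refl i)) j

  ^-∙ : ∀ {x y} → Commute x y → ∀ k → (x ∙ y) ^ k ≡ (x ^ k) ∙ (y ^ k)
  ^-∙ c zero = sym (identityˡ ε)
  ^-∙ {x} {y} c (suc k) = begin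
    (x ∙ y) ∙ ((x ∙ y) ^ k)        ≡⟨ cong ((x ∙ y) ∙_) (^-∙ c k) ⟩
    (x ∙ y) ∙ ((x ^ k) ∙ (y ^ k))  ≡⟨ assoc x y _ ⟩
    x ∙ (y ∙ ((x ^ k) ∙ (y ^ k)))  ≡⟨ cong (x ∙_) (assoc y (x ^ k) (y ^ k)) ⟨
    x ∙ ((y ∙ (x ^ k)) ∙ (y ^ k))  ≡⟨ cong (λ z → x ∙ (z ∙ (y ^ k))) (commute-^ (sym c) k) ⟩
    x ∙ (((x ^ k) ∙ y) ∙ (y ^ k))  ≡⟨ cong (x ∙_) (assoc (x ^ k) y (y ^ k)) ⟩
    x ∙ ((x ^ k) ∙ (y ∙ (y ^ k)))  ≡⟨ assoc x (x ^ k) _ ⟨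
    (x ^ suc k) ∙ (y ^ suc k)      ∎
    where open ≡-Reasoning

  ^-∸ : ∀ x {i j} → i ≤ j → x ^ i ≡ x ^ j → x ^ (j ∸ i) ≡ ε
  ^-∸ x {i} {j} i≤j e = ∙-cancelˡ (x ^ i) _ _ (begin
    (x ^ i) ∙ (x ^ (j ∸ i))  ≡⟨ ^-+ x i (j ∸ i) ⟨
    x ^ (i + (j ∸ i))        ≡⟨ cong (x ^_) (m+[n∸m]≡n i≤j) ⟩
    x ^ j                    ≡⟨ e ⟨
    x ^ i                    ≡⟨ identityʳ _ ⟨
    (x ^ i) ∙ ε              ∎)
    where open ≡-Reasoning

  -- Two of the first `|G| + 1` powers coincide; the difference of their exponents is a period from
  -- which the search for the least one starts.
  order : ∀ x → ∃[ d ] ((0 < d × x ^ d ≡ ε) × ∀ k → 0 < k × x ^ k ≡ ε → d ≤ k)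
  order x = let i , j , i<j , e = pigeonhole (n<1+n |G|) (λ i → x ^ toℕ i) in
    least (λ k → (0 <? k) ×-dec ((x ^ k) ≟ ε)) (toℕ j ∸ toℕ i) (m<n⇒0<n∸m i<j , ^-∸ x (<⇒≤ i<j) e)

  -- Opaque, so that `ord x` is known only through its three properties and never unfolds into the
  -- search behind it.
  opaque
    ord : Carrier → ℕ
    ord x = proj₁ (order x)

    ord>0 : ∀ x → 0 < ord x
    ord>0 x = proj₁ (proj₁ (proj₂ (order x)))

    ^-ord : ∀ x → x ^ ord x ≡ ε
    ^-ord x = proj₂ (proj₁ (proj₂ (order x)))

    ord-≤ : ∀ x {k} → 0 < k → x ^ k ≡ ε → ord x ≤ k
    ord-≤ x {k} 0<k e = proj₂ (proj₂ (order x)) k (0<k , e)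

  instance
    ord-nonZero : ∀ {x} → NonZero (ord x)
    ord-nonZero {x} = >-nonZero (ord>0 x)

  ^-% : ∀ x k → x ^ k ≡ x ^ (k % ord x)
  ^-% x k = begin
    x ^ k                                          ≡⟨ cong (x ^_) (m≡m%n+[m/n]*n k (ord x)) ⟩
    x ^ (k % ord x + k / ord x * ord x)            ≡⟨ ^-+ x (k % ord x) _ ⟩
    (x ^ (k % ord x)) ∙ (x ^ (k / ord x * ord x))  ≡⟨ cong ((x ^ (k % ord x)) ∙_) (^-*-ε x (k / ord x) (ord x) (^-ord x)) ⟩
    (x ^ (k % ord x)) ∙ ε                          ≡⟨ identityʳ _ ⟩
    x ^ (k % ord x)                                ∎
    where open ≡-Reasoning

  ord-∣ : ∀ x {k} → x ^ k ≡ ε → ord x ∣ k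
  ord-∣ x {k} e = m%n≡0⇒n∣m k (ord x) (zero-rem (k % ord x) (m%n<n k (ord x)) (trans (sym (^-% x k)) e))
    where
    zero-rem : ∀ r → r < ord x → x ^ r ≡ ε → r ≡ 0
    zero-rem zero    _   _ = refl
    zero-rem (suc r) r<o e = contradiction (ord-≤ x (s≤s z≤n) e) (<⇒≱ r<o)

  ^-injective : ∀ x {i j} → i < j → j < ord x → x ^ i ≢ x ^ j
  ^-injective x {i} {j} i<j j<o e = <⇒≱ (≤-<-trans (m∸n≤m j i) j<o)
    (ord-≤ x (m<n⇒0<n∸m i<j) (^-∸ x (<⇒≤ i<j) e))

  ^-toℕ-injective : ∀ x (i j : Fin (ord x)) → x ^ toℕ i ≡ x ^ toℕ j → i ≡ j
  ^-toℕ-injective x i j e with ℕ.<-cmp (toℕ i) (toℕ j)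
  ... | tri< i<j _ _ = contradiction e (^-injective x i<j (toℕ<n j))
  ... | tri≈ _ i≡j _ = toℕ-injective i≡j
  ... | tri> _ _ j<i = contradiction (sym e) (^-injective x j<i (toℕ<n i))

  infix 4 _∈⟨_⟩ _∈⟨_⟩?
  _∈⟨_⟩ : Carrier → Carrier → Set
  y ∈⟨ x ⟩ = ∃[ k ] y ≡ x ^ k

  exponent : ∀ {x y} → y ∈⟨ x ⟩ → ∃[ i ] x ^ toℕ {ord x} i ≡ y
  exponent {x} (k , refl) = fromℕ< (m%n<n k (ord x)) ,
    trans (cong (x ^_) (toℕ-fromℕ< (m%n<n k (ord x)))) (sym (^-% x k))

  _∈⟨_⟩? : ∀ y x → Dec (y ∈⟨ x ⟩)
  y ∈⟨ x ⟩? = map′ (λ (i , e) → toℕ i , sym e) exponent (any? (λ i → (x ^ toℕ {ord x} i) ≟ y))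

  -- The exponents below `ord x` correspond one to one to the elements of the cyclic subgroup, so
  -- counts in it become counts of exponents.
  count-∈⟨⟩ : ∀ x {P : Carrier → Set} (P? : Decidable P) →
    count {n = ord x} (λ i → P? (x ^ toℕ i)) ≡ count (λ y → (y ∈⟨ x ⟩?) ×-dec P? y)
  count-∈⟨⟩ x {P} P? = count-bijection (λ i → P? (x ^ toℕ i)) (λ y → (y ∈⟨ x ⟩?) ×-dec P? y) (λ i → x ^ toℕ i)
    (λ i pi → (toℕ i , refl) , pi)
    (λ i j _ _ → ^-toℕ-injective x i j)
    (λ { y (y∈ , py) → let i , e = exponent y∈ in i , subst P (sym e) py , e })

  ord≡count : ∀ x → count (_∈⟨ x ⟩?) ≡ ord x
  ord≡count x = trans (trans
    (count-cong (_∈⟨ x ⟩?) (λ y → (y ∈⟨ x ⟩?) ×-dec yes tt) (λ _ y∈ → y∈ , tt) (λ _ → proj₁))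
    (sym (count-∈⟨⟩ x {P = λ _ → ⊤} (λ _ → yes tt))))
    (count-all {P = λ _ → ⊤} (λ (_ : Fin (ord x)) → yes tt) (λ _ → tt))

  ∈⟨⟩-refl : ∀ {x} → x ∈⟨ x ⟩
  ∈⟨⟩-refl {x} = 1 , sym (^1 x)

  ε∈⟨⟩ : ∀ {x} → ε ∈⟨ x ⟩
  ε∈⟨⟩ = 0 , refl

  ∈⟨⟩-trans : ∀ {x y z} → x ∈⟨ y ⟩ → y ∈⟨ z ⟩ → x ∈⟨ z ⟩
  ∈⟨⟩-trans {z = z} (i , refl) (j , refl) = i * j , sym (^-* z i j)

  ^-∈⟨⟩ : ∀ {x} k → x ^ k ∈⟨ x ⟩
  ^-∈⟨⟩ k = k , refl

  ∙-∈⟨⟩ : ∀ {x y z} → x ∈⟨ z ⟩ → y ∈⟨ z ⟩ → x ∙ y ∈⟨ z ⟩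
  ∙-∈⟨⟩ {z = z} (i , refl) (j , refl) = i + j , sym (^-+ z i j)

  -- The inverse is the power with exponent `ord x` minus one, so natural exponents describe the
  -- whole cyclic subgroup.
  ⁻¹-∈⟨⟩ : ∀ {x} → x ⁻¹ ∈⟨ x ⟩
  ⁻¹-∈⟨⟩ {x} = ℕ.pred (ord x) , sym (inverseʳ-unique x _
    (trans (cong (x ^_) (suc-pred (ord x))) (^-ord x)))

  ∙-cancelˡ-∈⟨⟩ : ∀ {x y z} → x ∈⟨ z ⟩ → x ∙ y ∈⟨ z ⟩ → y ∈⟨ z ⟩
  ∙-cancelˡ-∈⟨⟩ {x} {y} x∈ xy∈ = subst (_∈⟨ _ ⟩)
    (trans (sym (assoc _ _ _)) (trans (cong (_∙ y) (inverseˡ x)) (identityˡ y)))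
    (∙-∈⟨⟩ (∈⟨⟩-trans ⁻¹-∈⟨⟩ x∈) xy∈)

  commute-∈⟨⟩ : ∀ {x y z} → x ∈⟨ z ⟩ → y ∈⟨ z ⟩ → Commute x y
  commute-∈⟨⟩ {z = z} (i , refl) (j , refl) = powers-commute z i j

  -- By Bézout, `gcd i m` is modulo `m` a multiple of `i` up to sign; a negative sign is absorbed by
  -- taking an inverse.
  ^-gcd-∈⟨⟩ : ∀ x i {m} → x ^ m ≡ ε → x ^ gcd i m ∈⟨ x ^ i ⟩
  ^-gcd-∈⟨⟩ x i {m} e with Bézout.identity (gcd-GCD i m)
  ... | Bézout.+- a b eq = a , (begin
    x ^ gcd i m                    ≡⟨ identityʳ _ ⟨
    (x ^ gcd i m) ∙ ε              ≡⟨ cong ((x ^ gcd i m) ∙_) (^-*-ε x b m e) ⟨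
    (x ^ gcd i m) ∙ (x ^ (b * m))  ≡⟨ ^-+ x (gcd i m) (b * m) ⟨
    x ^ (gcd i m + b * m)          ≡⟨ cong (x ^_) eq ⟩
    x ^ (a * i)                    ≡⟨ ^-* x a i ⟩
    (x ^ i) ^ a                    ∎)
    where open ≡-Reasoning
  ... | Bézout.-+ a b eq = subst (_∈⟨ x ^ i ⟩) (sym (inverseˡ-unique _ _ (begin
    (x ^ gcd i m) ∙ ((x ^ i) ^ a)  ≡⟨ cong ((x ^ gcd i m) ∙_) (^-* x a i) ⟨
    (x ^ gcd i m) ∙ (x ^ (a * i))  ≡⟨ ^-+ x (gcd i m) (a * i) ⟨
    x ^ (gcd i m + a * i)          ≡⟨ cong (x ^_) eq ⟩
    x ^ (b * m)                    ≡⟨ ^-*-ε x b m e ⟩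
    ε                              ∎))) (∈⟨⟩-trans ⁻¹-∈⟨⟩ (a , refl))
    where open ≡-Reasoning

  coprime-∈⟨⟩ : ∀ x {i m} → x ^ m ≡ ε → Coprime i m → x ∈⟨ x ^ i ⟩
  coprime-∈⟨⟩ x {i} {m} e c = subst (_∈⟨ x ^ i ⟩) (trans (cong (x ^_) (coprime⇒gcd≡1 c)) (^1 x)) (^-gcd-∈⟨⟩ x i e)

  conj : Carrier → Carrier → Carrier
  conj g y = g ∙ (y ∙ (g ⁻¹))

  conj-ε : ∀ y → conj ε y ≡ y
  conj-ε y = trans (identityˡ _) (trans (cong (y ∙_) ε⁻¹≈ε) (identityʳ y))

  conj-∘ : ∀ g h y → conj (g ∙ h) y ≡ conj g (conj h y)
  conj-∘ g h y = begin
    (g ∙ h) ∙ (y ∙ ((g ∙ h) ⁻¹))         ≡⟨ assoc g h _ ⟩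
    g ∙ (h ∙ (y ∙ ((g ∙ h) ⁻¹)))         ≡⟨ cong (λ z → g ∙ (h ∙ (y ∙ z))) (⁻¹-anti-homo-∙ g h) ⟩
    g ∙ (h ∙ (y ∙ ((h ⁻¹) ∙ (g ⁻¹))))    ≡⟨ cong (λ z → g ∙ (h ∙ z)) (assoc y (h ⁻¹) (g ⁻¹)) ⟨
    g ∙ (h ∙ ((y ∙ (h ⁻¹)) ∙ (g ⁻¹)))    ≡⟨ cong (g ∙_) (assoc h _ (g ⁻¹)) ⟨
    g ∙ ((h ∙ (y ∙ (h ⁻¹))) ∙ (g ⁻¹))    ∎
    where open ≡-Reasoning

  conj-inverse : ∀ g y → conj (g ⁻¹) (conj g y) ≡ y
  conj-inverse g y = trans (sym (conj-∘ (g ⁻¹) g y)) (trans (cong (λ h → conj h y) (inverseˡ g)) (conj-ε y))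

  conj-injective : ∀ g {x y} → conj g x ≡ conj g y → x ≡ y
  conj-injective g {x} {y} e = trans (sym (conj-inverse g x)) (trans (cong (conj (g ⁻¹)) e) (conj-inverse g y))

  conj-shift : ∀ g y → conj g y ∙ g ≡ g ∙ y
  conj-shift g y = trans (assoc g _ g) (cong (g ∙_)
    (trans (assoc y _ g) (trans (cong (y ∙_) (inverseˡ g)) (identityʳ y))))

  conj-fixed⇒commute : ∀ {g y} → conj g y ≡ y → Commute g y
  conj-fixed⇒commute {g} {y} e = trans (sym (conj-shift g y)) (cong (_∙ g) e)

  commute⇒conj-fixed : ∀ {g y} → Commute g y → conj g y ≡ y
  commute⇒conj-fixed {g} {y} c = ∙-cancelʳ g _ _ (trans (conj-shift g y) c)

  conj-^ : ∀ g y k → conj g y ^ k ≡ conj g (y ^ k)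
  conj-^ g y zero = sym (commute⇒conj-fixed (trans (identityʳ g) (sym (identityˡ g))))
  conj-^ g y (suc k) = ∙-cancelʳ g _ _ (begin
    (conj g y ∙ (conj g y ^ k)) ∙ g   ≡⟨ cong (λ z → (conj g y ∙ z) ∙ g) (conj-^ g y k) ⟩
    (conj g y ∙ conj g (y ^ k)) ∙ g   ≡⟨ assoc _ _ g ⟩
    conj g y ∙ (conj g (y ^ k) ∙ g)   ≡⟨ cong (conj g y ∙_) (conj-shift g (y ^ k)) ⟩
    conj g y ∙ (g ∙ (y ^ k))          ≡⟨ assoc _ g _ ⟨
    (conj g y ∙ g) ∙ (y ^ k)          ≡⟨ cong (_∙ (y ^ k)) (conj-shift g y) ⟩
    (g ∙ y) ∙ (y ^ k)                 ≡⟨ assoc g y _ ⟩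
    g ∙ (y ∙ (y ^ k))                 ≡⟨ conj-shift g (y ^ suc k) ⟨
    conj g (y ^ suc k) ∙ g            ∎)
    where open ≡-Reasoning

  -- Together with `fold-∙`, this shows that conjugation and right translation by `w` have period
  -- `p` once `w ^ p ≡ ε`, as `FreeAction` requires.
  fold-conj : ∀ g y i → fold y (conj g) i ≡ conj (g ^ i) y
  fold-conj g y zero    = sym (conj-ε y)
  fold-conj g y (suc i) = trans (cong (conj g) (fold-conj g y i)) (sym (conj-∘ g (g ^ i) y))

  fold-∙ : ∀ w y i → fold y (_∙ w) i ≡ y ∙ (w ^ i)
  fold-∙ w y zero    = sym (identityʳ y)
  fold-∙ w y (suc i) = trans (cong (_∙ w) (fold-∙ w y i)) (trans (assoc y _ w)
    (cong (y ∙_) (sym (commute-^ refl i))))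

  Conjugate : Carrier → Carrier → Set
  Conjugate y z = ∃[ g ] conj g y ≡ z

  Conjugate? : ∀ y z → Dec (Conjugate y z)
  Conjugate? y z = any? (λ g → conj g y ≟ z)

  Conjugate-euclidean : ∀ {x y z} → Conjugate x y → Conjugate z y → Conjugate x z
  Conjugate-euclidean {x} {y} {z} (g , refl) (h , e) = (h ⁻¹) ∙ g ,
    trans (conj-∘ (h ⁻¹) g x) (trans (cong (conj (h ⁻¹)) (sym e)) (conj-inverse h z))

  Commute? : ∀ x y → Dec (Commute x y)
  Commute? x y = (x ∙ y) ≟ (y ∙ x)

  -- Double counting of the pairs `(g , conj g y)`: the fibre over `conj h y` is the left coset by
  -- `h` of the centralizer of `y`.
  orbit-stabilizer : ∀ y → |G| ≡ count (Conjugate? y) * count (λ c → Commute? c y)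
  orbit-stabilizer y = trans (trans (sym (count-all {P = λ _ → ⊤} (λ (_ : Carrier) → yes tt) (λ _ → tt))) (sym (*-identityʳ _)))
    (double-count {P = λ _ → ⊤} (λ (_ : Carrier) → yes tt) (Conjugate? y) (λ g z → conj g y ≟ z) 1 _
      (λ g z e → tt , (g , e))
      (λ g _ → count-≡ (conj g y))
      λ { z (h , refl) → sym (count-bijection (λ c → Commute? c y) (λ g → conj g y ≟ conj h y) (h ∙_)
            (λ c cy → trans (conj-∘ h c y) (cong (conj h) (commute⇒conj-fixed cy)))
            (λ c d _ _ e → ∙-cancelˡ h c d e)
            (λ g e → (h ⁻¹) ∙ g ,
              conj-fixed⇒commute (trans (conj-∘ (h ⁻¹) g y) (trans (cong (conj (h ⁻¹)) e) (conj-inverse h y))) ,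
              trans (sym (assoc h (h ⁻¹) g)) (trans (cong (_∙ g) (inverseʳ h)) (identityˡ g)))) })

-- Prime powers

prime-dichotomy : ∀ {p} → Prime p → ∀ d → p ∣ d ⊎ Coprime d p
prime-dichotomy {p} pr d with prime⇒irreducible pr (gcd[m,n]∣n d p)
... | inj₁ gcd≡1 = inj₂ (gcd≡1⇒coprime gcd≡1)
... | inj₂ gcd≡p = inj₁ (subst (_∣ d) gcd≡p (gcd[m,n]∣m d p))

primes-coprime : ∀ {p q} → Prime p → Prime q → q ≢ p → Coprime p q
primes-coprime {p} {q} p-prime q-prime q≢p with prime-dichotomy q-prime p
... | inj₂ coprime = coprime
... | inj₁ q∣p with prime⇒irreducible p-prime q∣p
...   | inj₁ refl = contradiction q-prime ¬prime[1]
...   | inj₂ q≡p = contradiction q≡p q≢p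

∣-prime-power : ∀ {p} → Prime p → ∀ b {d} → d ∣ p ℕ.^ b → ∃[ c ] d ≡ p ℕ.^ c
∣-prime-power pr zero d∣1 = 0 , ∣1⇒≡1 d∣1
∣-prime-power {p} pr (suc b) {d} d∣ with prime-dichotomy pr d
... | inj₂ coprime = ∣-prime-power pr b (coprime-divisor coprime d∣)
... | inj₁ (divides e refl) =
  let c , e≡ = ∣-prime-power pr b (*-cancelʳ-∣ p {{prime⇒nonZero pr}} (subst (e * p ∣_) (*-comm p (p ℕ.^ b)) d∣))
  in suc c , trans (*-comm e p) (cong (p *_) e≡)

^-mono-∣ : ∀ p {c d} → c ≤ d → p ℕ.^ c ∣ p ℕ.^ d
^-mono-∣ p {c} {d} c≤d = subst (p ℕ.^ c ∣_)
  (trans (sym (^-distribˡ-+-* p c (d ∸ c))) (cong (p ℕ.^_) (m+[n∸m]≡n c≤d)))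
  (m∣m*n (p ℕ.^ (d ∸ c)))

product-constant : ∀ {p ps} → All (p ≡_) ps → product ps ≡ p ℕ.^ length ps
product-constant [] = refl
product-constant {p} (refl ∷ eqs) = cong (p *_) (product-constant eqs)

1<pr : ∀ {p} → Prime p → 1 < p
1<pr {p} pr = nonTrivial⇒n>1 p {{prime⇒nonTrivial pr}}

distinct⇒2≤ : {x y : Fin n} → x ≢ y → 2 ≤ n
distinct⇒2≤ {n = 1} {zero} {zero} x≢y = contradiction refl x≢y
distinct⇒2≤ {n = suc (suc n)} _ = s≤s (s≤s z≤n)

distinct-from : 2 ≤ n → (x : Fin n) → ∃[ y ] x ≢ y
distinct-from {n = suc (suc n)} _ zero    = suc zero , λ ()
distinct-from {n = suc (suc n)} _ (suc x) = zero , λ ()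
distinct-from {n = 1} (s≤s ())

-- Since `k` divides `suc g`, it is coprime to `g`; it divides `s * δ = g * c`, so `c = c′ * k`.
-- Cancelling `k` leaves `g * c′` as a multiple of `δ`, and `g = k * δ + (k - 1)`, so `δ` divides
-- `c′ * (k - 1)`. This is less than `c ≤ δ`, hence zero.
index-arithmetic : ∀ {c g k s δ} → g * c ≡ s * δ → suc g ≡ k * suc δ → k ∣ s → 1 ≤ c → c ≤ δ → k ≡ 1
index-arithmetic {k = zero} _ () _ _ _
index-arithmetic {c} {g} {suc k} {s} {δ} gc≡sδ 1+g≡ (divides t refl) 1≤c c≤δ
  with coprime-divisor {suc k} {g} {c} coprime (divides (t * δ) (trans gc≡sδ tδk))
  where
  tδk : t * suc k * δ ≡ t * δ * suc k
  tδk = trans (*-assoc t (suc k) δ) (trans (cong (t *_) (*-comm (suc k) δ)) (sym (*-assoc t δ (suc k))))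
  coprime : Coprime (suc k) g
  coprime {d} (d∣k , d∣g) = ∣1⇒≡1 (∣m+n∣m⇒∣n
    (subst (d ∣_) (trans (sym 1+g≡) (+-comm 1 g)) (∣-trans d∣k (m∣m*n (suc δ)))) d∣g)
... | divides zero refl = contradiction 1≤c λ ()
... | divides c′@(suc c″) refl = cong suc (k≡0 k c′k<δ δ∣c′k)
  where
  open ≡-Reasoning
  g≡ : g ≡ suc k * δ + k
  g≡ = suc-injective (trans 1+g≡ (trans (*-suc (suc k) δ) (cong suc (+-comm k (suc k * δ)))))
  δ∣c′k : δ ∣ c′ * k
  δ∣c′k = ∣m+n∣m⇒∣n (subst (δ ∣_) (begin
    t * δ                           ≡⟨ *-cancelʳ-≡ (t * δ) (g * c′) (suc k) (begin
      t * δ * suc k                   ≡⟨ *-assoc t δ (suc k) ⟩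
      t * (δ * suc k)                 ≡⟨ cong (t *_) (*-comm δ (suc k)) ⟩
      t * (suc k * δ)                 ≡⟨ *-assoc t (suc k) δ ⟨
      t * suc k * δ                   ≡⟨ gc≡sδ ⟨
      g * (c′ * suc k)                ≡⟨ *-assoc g c′ (suc k) ⟨
      g * c′ * suc k                  ∎) ⟩
    g * c′                          ≡⟨ cong (_* c′) g≡ ⟩
    (suc k * δ + k) * c′            ≡⟨ *-distribʳ-+ c′ (suc k * δ) k ⟩
    suc k * δ * c′ + k * c′         ≡⟨ cong (suc k * δ * c′ +_) (*-comm k c′) ⟩
    suc k * δ * c′ + c′ * k         ∎) (n∣m*n t))
    (∣m⇒∣m*n c′ (n∣m*n (suc k)))
  c′k<δ : c′ * k < δ
  c′k<δ = <-≤-trans (*-monoʳ-< c′ (n<1+n k)) c≤δ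
  k≡0 : ∀ k → c′ * k < δ → δ ∣ c′ * k → k ≡ 0
  k≡0 zero _ _ = refl
  k≡0 (suc k) lt δ∣ = contradiction (∣⇒≤ δ∣) (<⇒≱ lt)

-- Power graphs

module PowerGraph (G : FiniteGroup) where
  open GroupTheory G public

  Γ : Graph
  Γ = powerGraph G

  -- Adjacency with loops added: closed neighbourhoods can be compared directly with cyclic
  -- subgroups.
  Comparable : Carrier → Carrier → Set
  Comparable x y = y ∈⟨ x ⟩ ⊎ x ∈⟨ y ⟩

  Comparable? : ∀ x y → Dec (Comparable x y)
  Comparable? x y = (y ∈⟨ x ⟩?) ⊎-dec (x ∈⟨ y ⟩?)

  -- The power graph asks for positive exponents, so the exponent 0 is traded for `ord x`.
  positive-exponent : ∀ {x y} → y ∈⟨ x ⟩ → ∃[ k ] (0 < k × y ≡ x ^ k)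
  positive-exponent {x} (zero  , refl) = ord x , ord>0 x , sym (^-ord x)
  positive-exponent (suc k , e) = suc k , s≤s z≤n , e

  comparable⇒adjacent : ∀ {x y} → x ≢ y → Comparable x y → Adj Γ x y
  comparable⇒adjacent x≢y (inj₁ y∈) = x≢y , inj₁ (positive-exponent y∈)
  comparable⇒adjacent x≢y (inj₂ x∈) = x≢y , inj₂ (positive-exponent x∈)

  adjacent⇒comparable : ∀ {x y} → Adj Γ x y → Comparable x y
  adjacent⇒comparable (_ , inj₁ (k , _ , e)) = inj₁ (k , e)
  adjacent⇒comparable (_ , inj₂ (k , _ , e)) = inj₂ (k , e)

  adj? : ∀ x y → Dec (Adj Γ x y)
  adj? x y = map′ (uncurry comparable⇒adjacent) (λ xy → proj₁ xy , adjacent⇒comparable xy)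
    (¬? (x ≟ y) ×-dec Comparable? x y)

  degree : Carrier → ℕ
  degree x = count (adj? x)

  count-Comparable : ∀ x → count (Comparable? x) ≡ suc (degree x)
  count-Comparable x = trans (count-remove (Comparable? x) x (inj₁ ∈⟨⟩-refl)) (cong suc
    (count-cong (λ y → Comparable? x y ×-dec ¬? (x ≟ y)) (adj? x)
      (λ _ (c , x≢y) → comparable⇒adjacent x≢y c)
      (λ _ xy → adjacent⇒comparable xy , proj₁ xy)))

  ε-dominating : ∀ x → x ≢ ε → Adj Γ x ε
  ε-dominating x x≢ε = comparable⇒adjacent x≢ε (inj₁ ε∈⟨⟩)

  degree-ε : suc (degree ε) ≡ |G|
  degree-ε = trans (sym (count-Comparable ε)) (count-all (Comparable? ε) (λ _ → inj₂ ε∈⟨⟩))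

  connected : Connected Γ
  connected x y = from x ◅◅ reverse (Graph.sym Γ) (from y)
    where
    from : ∀ x → Star (Adj Γ) x ε
    from x with x ≟ ε
    ... | yes refl = ε⋆
    ... | no x≢ε = ε-dominating x x≢ε ◅ ε⋆

  -- As `x ^ k` is not `ε`, the prime `p` does not divide `k`, so `k` is invertible modulo `p`.
  ∈⟨⟩-prime : ∀ {p x y} → Prime p → x ^ p ≡ ε → y ∈⟨ x ⟩ → y ≢ ε → x ∈⟨ y ⟩
  ∈⟨⟩-prime {x = x} pr e (k , refl) y≢ε with prime-dichotomy pr k
  ... | inj₁ p∣k = contradiction (∣⇒^≡ε x e p∣k) y≢ε
  ... | inj₂ coprime = coprime-∈⟨⟩ x e coprime

  ord-prime : ∀ {p x} → Prime p → x ^ p ≡ ε → x ≢ ε → ord x ≡ p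
  ord-prime {x = x} pr e x≢ε with prime⇒irreducible pr (ord-∣ x e)
  ... | inj₂ ord≡p = ord≡p
  ... | inj₁ ord≡1 = contradiction (trans (sym (^1 x)) (subst (λ k → x ^ k ≡ ε) ord≡1 (^-ord x))) x≢ε

  -- Non-cyclic groups of prime exponent

  module Forward (¬cyclic : ¬ IsCyclic G) (p : ℕ) (pr : Prime p) (exponent-p : ∀ x → x ^ p ≡ ε) where

    nontrivial : ∃[ x ] x ≢ ε
    nontrivial with any? (λ x → ¬? (x ≟ ε))
    ... | yes w = w
    ... | no none = contradiction (ε , λ x → 0 , decidable-stable (x ≟ ε) (λ x≢ε → none (x , x≢ε))) ¬cyclic

    2≤|G| : 2 ≤ |G|
    2≤|G| = distinct⇒2≤ (proj₂ nontrivial)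

    -- Non-trivial powers generate back, so the closed neighbourhood of `x` is just its cyclic
    -- subgroup. If the graph were complete, `x` would therefore generate `G`.
    comparable⇒∈⟨⟩ : ∀ {x} → x ≢ ε → ∀ y → Comparable x y → y ∈⟨ x ⟩
    comparable⇒∈⟨⟩ x≢ε y (inj₁ y∈) = y∈
    comparable⇒∈⟨⟩ x≢ε y (inj₂ x∈) = ∈⟨⟩-prime pr (exponent-p y) x∈ x≢ε

    non-complete : ¬ Complete Γ
    non-complete complete = let x , x≢ε = nontrivial in
      ¬cyclic (x , λ y → comparable⇒∈⟨⟩ x≢ε y (all-comparable x y))
      where
      all-comparable : ∀ x y → Comparable x y
      all-comparable x y with x ≟ y
      ... | yes refl = inj₁ ∈⟨⟩-refl
      ... | no x≢y = adjacent⇒comparable (complete x y x≢y)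

    suc-degree : ∀ {x} → x ≢ ε → suc (degree x) ≡ p
    suc-degree {x} x≢ε = begin
      suc (degree x)          ≡⟨ count-Comparable x ⟨
      count (Comparable? x)   ≡⟨ count-cong (Comparable? x) (_∈⟨ x ⟩?) (comparable⇒∈⟨⟩ x≢ε) (λ _ → inj₁) ⟩
      count (_∈⟨ x ⟩?)        ≡⟨ ord≡count x ⟩
      ord x                   ≡⟨ ord-prime pr (exponent-p x) x≢ε ⟩
      p                       ∎
      where open ≡-Reasoning

    degree-≥ : ∀ x → p ∸ 1 ≤ degree x
    degree-≥ x with x ≟ ε
    ... | no x≢ε = ≤-reflexive (cong (_∸ 1) (sym (suc-degree x≢ε)))
    ... | yes refl = let y , y≢ε = nontrivial in ≤-pred (begin
      suc (p ∸ 1)             ≡⟨ suc-pred p {{prime⇒nonZero pr}} ⟩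
      p                       ≡⟨ suc-degree y≢ε ⟨
      suc (degree y)          ≡⟨ count-Comparable y ⟨
      count (Comparable? y)   ≤⟨ count-mono (Comparable? y) (Comparable? ε) (λ _ _ → inj₂ ε∈⟨⟩) ⟩
      count (Comparable? ε)   ≡⟨ count-Comparable ε ⟩
      suc (degree ε)          ∎)
      where open ≤-Reasoning

    minimally : MinimallyEdgeConnected Γ
    minimally = 2≤|G| , connected , critical
      where
      critical : ∀ a b → Adj Γ a b → ∀ k → EdgeConnectivity Γ k → EdgeConnectivity (deleteEdge Γ a b) (k ∸ 1)
      critical a b ab k (inj₁ (V<2 , _)) = contradiction 2≤|G| (<⇒≱ V<2)
      critical a b ab k (inj₂ (_ , (F , length-F , F-disconnecting) , minimum)) =
        inj₂ (2≤|G| , cut (a ≟ ε) , λ F′ d → ∸-monoˡ-≤ 1 (minimum ((a , b) ∷ F′) (extend F′ d)))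
        where
        del? = deleteEdge-adj? Γ adj? a b
        -- Gives the lower bound `k ∸ 1`: a cut of the smaller graph together with the deleted edge
        -- is a cut of `Γ`.
        extend : ∀ F′ → Disconnecting (deleteEdge Γ a b) F′ → Disconnecting Γ ((a , b) ∷ F′)
        extend F′ d connected′ = d λ u v → map⋆
          (λ (uv , uv∉ , vu∉) →
            (uv , (λ { (here e) → uv∉ (here e) }) , (λ { (here e) → vu∉ (here e) })) , uv∉ ∘ there , vu∉ ∘ there)
          (connected′ u v)
        -- Nothing is deleted yet, so `ε` dominates without exception and also fills the place of
        -- the exceptional vertex.
        p-1≤k : p ∸ 1 ≤ k
        p-1≤k = subst (p ∸ 1 ≤_) length-F
          (disconnecting-≥ Γ adj? ε ε (p ∸ 1) (λ v v≢ε _ → ε-dominating v v≢ε) degree-≥ F F-disconnecting)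
        -- Isolating `x` costs at most `p - 2` edges after the deletion, and no cut has fewer than
        -- `k - 1`; with `p ∸ 1 ≤ k` this makes the length exact.
        isolate : ∀ {x y} → x ≢ ε → x ≢ y → suc (count (del? x)) ≤ degree x →
          ∃[ F′ ] (length F′ ≡ k ∸ 1 × Disconnecting (deleteEdge Γ a b) F′)
        isolate {x} x≢ε x≢y drop with isolating-set (deleteEdge Γ a b) del? x≢y
        ... | F′ , length-F′ , d = F′ , cong (_∸ 1) (≤-antisym upper (minimum ((a , b) ∷ F′) (extend F′ d))) , d
          where
          open ≤-Reasoning
          upper : suc (length F′) ≤ k
          upper = begin
            suc (length F′)       ≡⟨ cong suc length-F′ ⟩
            suc (count (del? x))  ≤⟨ drop ⟩
            degree x              ≡⟨ cong (_∸ 1) (suc-degree x≢ε) ⟩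
            p ∸ 1                 ≤⟨ p-1≤k ⟩
            k                     ∎
        -- At least one end of the deleted edge is not `ε`; that end is isolated.
        cut : Dec (a ≡ ε) → ∃[ F′ ] (length F′ ≡ k ∸ 1 × Disconnecting (deleteEdge Γ a b) F′)
        cut (no a≢ε) = isolate a≢ε (proj₁ ab) (deleteEdge-degree-a Γ adj? a b ab)
        cut (yes refl) = isolate (proj₁ ab ∘ sym) (proj₁ ab ∘ sym) (deleteEdge-degree-b Γ adj? a b ab)

  -- Groups in which all non-identity elements have equal degree

  module Regular (δ : ℕ) (δ<|G| : suc δ < |G|) (x₁ : Carrier) (x₁≢ε : x₁ ≢ ε)
    (regular : ∀ {x} → x ≢ ε → count (Comparable? x) ≡ suc δ) where

    -- Encodes that `z` generates a maximal cyclic subgroup: that subgroup is the closed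
    -- neighbourhood of `z`, whose size `regular` prescribes.
    Maximal : Carrier → Set
    Maximal z = ord z ≡ suc δ

    ord-≤-|G| : ∀ z → ord z ≤ |G|
    ord-≤-|G| z = ≤-trans (≤-reflexive (sym (ord≡count z)))
      (≤-trans (count-mono (_∈⟨ z ⟩?) (λ (_ : Carrier) → yes tt) (λ _ _ → tt))
        (≤-reflexive (count-all {P = λ _ → ⊤} (λ (_ : Carrier) → yes tt) (λ _ → tt))))

    ∈⟨ε⟩ : ∀ {x} → x ∈⟨ ε ⟩ → x ≡ ε
    ∈⟨ε⟩ (k , e) = trans e (ε^ k)

    -- Climbs to strictly larger cyclic subgroups; orders grow and are bounded by `|G|`, which
    -- serves as fuel. At the top, everything comparable to `z` lies in its cyclic subgroup.
    maximal-cyclic : ∀ {x} → x ≢ ε → ∃[ z ] (x ∈⟨ z ⟩ × Maximal z)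
    maximal-cyclic {x} x≢ε = go |G| x ∈⟨⟩-refl (m<m+n |G| (ord>0 x))
      where
      go : ∀ fuel z → x ∈⟨ z ⟩ → |G| < fuel + ord z → ∃[ z ] (x ∈⟨ z ⟩ × Maximal z)
      go zero z _ lt = contradiction (ord-≤-|G| z) (<⇒≱ lt)
      go (suc fuel) z x∈ lt with any? (λ z′ → (z ∈⟨ z′ ⟩?) ×-dec ¬? (z′ ∈⟨ z ⟩?))
      ... | yes (z′ , z∈ , z′∉) = go fuel z′ (∈⟨⟩-trans x∈ z∈)
              (<-≤-trans lt (≤-trans (≤-reflexive (sym (+-suc fuel (ord z)))) (+-monoʳ-≤ fuel larger)))
        where
        larger : ord z < ord z′
        larger = ≰⇒> λ le → z′∉ (⊆∧count≥⇒⊇ (_∈⟨ z ⟩?) (_∈⟨ z′ ⟩?) (λ _ y∈ → ∈⟨⟩-trans y∈ z∈)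
          (≤-trans (≤-reflexive (ord≡count z′)) (≤-trans le (≤-reflexive (sym (ord≡count z))))) z′ ∈⟨⟩-refl)
      ... | no maximal = z , x∈ , (begin
        ord z                   ≡⟨ ord≡count z ⟨
        count (_∈⟨ z ⟩?)        ≡⟨ count-cong (_∈⟨ z ⟩?) (Comparable? z) (λ _ → inj₁) absorb ⟩
        count (Comparable? z)   ≡⟨ regular (λ { refl → x≢ε (∈⟨ε⟩ x∈) }) ⟩
        suc δ                   ∎)
        where
        open ≡-Reasoning
        absorb : ∀ y → Comparable z y → y ∈⟨ z ⟩
        absorb y (inj₁ y∈) = y∈
        absorb y (inj₂ z∈) = decidable-stable (y ∈⟨ z ⟩?) (λ y∉ → maximal (y , z∈ , y∉))

    z₁ : Carrier
    z₁ = proj₁ (maximal-cyclic x₁≢ε)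

    z₁-maximal : Maximal z₁
    z₁-maximal = proj₂ (proj₂ (maximal-cyclic x₁≢ε))

    exponent-suc-δ : ∀ x → x ^ suc δ ≡ ε
    exponent-suc-δ x with x ≟ ε
    ... | yes refl = ε^ (suc δ)
    ... | no x≢ε with maximal-cyclic x≢ε
    ...   | z , (k , refl) , z-maximal = trans (sym (^-* z (suc δ) k)) (trans (cong (z ^_) (*-comm (suc δ) k))
              (^-*-ε z k (suc δ) (subst (λ m → z ^ m ≡ ε) z-maximal (^-ord z))))

    non-cyclic : ¬ IsCyclic G
    non-cyclic (g , generates) = <⇒≢ δ<|G| (begin
      suc δ                   ≡⟨ regular (λ { refl → x₁≢ε (∈⟨ε⟩ (generates x₁)) }) ⟨
      count (Comparable? g)   ≡⟨ count-all (Comparable? g) (λ y → inj₁ (generates y)) ⟩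
      |G|                     ∎)
      where open ≡-Reasoning

    -- The witness has exponent `c = ord z / q`; it is not `ε` because `0 < c < ord z`.
    prime-order-element : ∀ {q z} → Prime q → q ∣ ord z → ∃[ u ] (u ∈⟨ z ⟩ × u ≢ ε × u ^ q ≡ ε)
    prime-order-element {q} {z} pr (divides c eq) = z ^ c , ^-∈⟨⟩ c ,
      (λ e → <⇒≱ (m<m*n c q {{>-nonZero 0<c}} (1<pr pr)) (subst (_≤ c) eq (ord-≤ z 0<c e))) ,
      trans (sym (^-* z q c)) (trans (cong (z ^_) (trans (*-comm q c) (sym eq))) (^-ord z))
      where
      0<c : 0 < c
      0<c = n≢0⇒n>0 (λ { refl → <⇒≢ (ord>0 z) (sym eq) })

    -- For u of prime order q, the elements y with u ∈⟨ y ⟩ number δ.  An element w of prime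
    -- order p ≠ q commuting with u acts freely on those commuting with w by y ↦ y w, and on
    -- the others by conjugation; hence p divides δ, and cannot divide δ + 1.
    prime-divisors-equal : ∀ {p q} → Prime p → Prime q → q ≢ p → p ∣ suc δ → ¬ q ∣ suc δ
    prime-divisors-equal {zero} p-prime _ _ _ _ = ¬prime[0] p-prime
    prime-divisors-equal {p@(suc r)} {q} p-prime q-prime q≢p p∣m q∣m =
      contradiction p-prime (subst (¬_ ∘ Prime) (sym (∣1⇒≡1 p∣1)) ¬prime[1])
      where
      u∃ = prime-order-element {z = z₁} q-prime (subst (q ∣_) (sym z₁-maximal) q∣m)
      w∃ = prime-order-element {z = z₁} p-prime (subst (p ∣_) (sym z₁-maximal) p∣m)
      u = proj₁ u∃
      w = proj₁ w∃
      u≢ε = proj₁ (proj₂ (proj₂ u∃))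
      w≢ε = proj₁ (proj₂ (proj₂ w∃))
      u^q = proj₂ (proj₂ (proj₂ u∃))
      w^p = proj₂ (proj₂ (proj₂ w∃))
      wu : Commute w u
      wu = commute-∈⟨⟩ (proj₁ (proj₂ w∃)) (proj₁ (proj₂ u∃))

      Above? : ∀ y → Dec (u ∈⟨ y ⟩)
      Above? y = u ∈⟨ y ⟩?

      -- Leaving out `ε`, the closed neighbourhood of `u` is `Above?`: a non-trivial power of `u`
      -- has `u` as a power, since `u` has prime order.
      count-Above : suc (count Above?) ≡ suc δ
      count-Above = trans (sym (trans (count-remove (Comparable? u) ε (inj₁ ε∈⟨⟩))
        (cong suc (count-cong (λ y → Comparable? u y ×-dec ¬? (ε ≟ y)) Above?
          (λ { y (inj₁ y∈ , ε≢y) → ∈⟨⟩-prime q-prime u^q y∈ (ε≢y ∘ sym) ; y (inj₂ u∈ , _) → u∈ })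
          (λ y u∈ → inj₂ u∈ , λ { refl → u≢ε (∈⟨ε⟩ u∈) })))))
        (regular u≢ε)

      Fixed? : ∀ y → Dec (conj w y ≡ y)
      Fixed? y = conj w y ≟ y

      -- Conjugation by `w` fixes `u`, hence preserves the relation `u ∈⟨ y ⟩`.
      p∣moved : p ∣ count (λ y → Above? y ×-dec ¬? (Fixed? y))
      p∣moved = FreeAction.count-∣ (conj w) r p-prime
        (λ y → trans (fold-conj w y p) (trans (cong (λ g → conj g y) w^p) (conj-ε y)))
        (λ y → Above? y ×-dec ¬? (Fixed? y))
        (λ { y ((k , u≡) , moved) →
          (k , trans (sym (commute⇒conj-fixed wu)) (trans (cong (conj w) u≡) (sym (conj-^ w y k)))) ,
          moved ∘ conj-injective w })
        (λ y → proj₂)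

      p∣fixed : p ∣ count (λ y → Above? y ×-dec Fixed? y)
      p∣fixed = FreeAction.count-∣ (_∙ w) r p-prime
        (λ y → trans (fold-∙ w y p) (trans (cong (y ∙_) w^p) (identityʳ y)))
        (λ y → Above? y ×-dec Fixed? y)
        (λ { y (u∈ , fixed) → above u∈ (conj-fixed⇒commute fixed) , commute⇒conj-fixed
          (trans (sym (assoc w y w)) (cong (_∙ w) (conj-fixed⇒commute fixed))) })
        (λ y _ yw≡y → w≢ε (∙-cancelˡ y w ε (trans yw≡y (sym (identityʳ y)))))
        where
        -- As `w ^ p ≡ ε`, raising to the power `p` removes `w`: `u ^ p` is a power of `y ∙ w`.
        -- Since `p` is coprime to `q`, `u` is a power of `u ^ p`.
        above : ∀ {y} → u ∈⟨ y ⟩ → Commute w y → u ∈⟨ y ∙ w ⟩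
        above {y} (k , u≡) wy = ∈⟨⟩-trans (coprime-∈⟨⟩ u {p} {q} u^q (primes-coprime p-prime q-prime q≢p))
          (∈⟨⟩-trans (k , (begin
            u ^ p                    ≡⟨ cong (_^ p) u≡ ⟩
            (y ^ k) ^ p              ≡⟨ ^-* y p k ⟨
            y ^ (p * k)              ≡⟨ cong (y ^_) (*-comm p k) ⟩
            y ^ (k * p)              ≡⟨ ^-* y k p ⟩
            (y ^ p) ^ k              ≡⟨ cong (_^ k) (identityʳ (y ^ p)) ⟨
            ((y ^ p) ∙ ε) ^ k        ≡⟨ cong (λ v → ((y ^ p) ∙ v) ^ k) w^p ⟨
            ((y ^ p) ∙ (w ^ p)) ^ k  ≡⟨ cong (_^ k) (^-∙ (sym wy) p) ⟨
            ((y ∙ w) ^ p) ^ k        ∎))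
          (^-∈⟨⟩ p))
          where open ≡-Reasoning

      p∣1 : p ∣ 1
      p∣1 = ∣m+n∣m⇒∣n (subst (p ∣_) (+-comm 1 δ) p∣m)
        (subst (p ∣_) (suc-injective count-Above) (subst (p ∣_) (sym (count-split Above? Fixed?)) (∣m∣n⇒∣m+n p∣fixed p∣moved)))

    -- Maximal cyclic subgroups of prime-power order

    module PrimePower (p : ℕ) (pr : Prime p) (a : ℕ) (m≡pᵃ : suc δ ≡ p ℕ.^ a) where

      maximal-^ : ∀ {z} → Maximal z → z ^ (p ℕ.^ a) ≡ ε
      maximal-^ {z} z-maximal = subst (λ m → z ^ m ≡ ε) (trans z-maximal m≡pᵃ) (^-ord z)

      -- Subgroups of a cyclic `p`-group form a chain: `z ^ i` generates `z ^ gcd i (p ^ a)`, and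
      -- these gcds are powers of `p`, of which one divides the other.
      chain : ∀ {x y z} → Maximal z → x ∈⟨ z ⟩ → y ∈⟨ z ⟩ → Comparable x y
      chain {z = z} z-maximal (i , refl) (j , refl)
        with ∣-prime-power pr a (gcd[m,n]∣n i (p ℕ.^ a)) | ∣-prime-power pr a (gcd[m,n]∣n j (p ℕ.^ a))
      ... | b , gcd-i | c , gcd-j = [ inj₁ ∘ below i j gcd-i gcd-j , inj₂ ∘ below j i gcd-j gcd-i ]′ (≤-total b c)
        where
        below : ∀ {b c} i j → gcd i (p ℕ.^ a) ≡ p ℕ.^ b → gcd j (p ℕ.^ a) ≡ p ℕ.^ c → b ≤ c → z ^ j ∈⟨ z ^ i ⟩
        below i j gcd-i gcd-j b≤c
          with ∣-trans (subst (_∣ _) (sym gcd-i) (subst (_ ∣_) (sym gcd-j) (^-mono-∣ p b≤c))) (gcd[m,n]∣m j (p ℕ.^ a))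
        ... | divides t j≡ = ∈⟨⟩-trans (t , trans (cong (z ^_) j≡) (^-* z t _))
              (^-gcd-∈⟨⟩ z i (maximal-^ z-maximal))

      -- By `chain`, the subgroup of `z` is contained in the closed neighbourhood of `x`; both have
      -- `suc δ` elements.
      component : ∀ {x z} → x ≢ ε → x ∈⟨ z ⟩ → Maximal z → ∀ y → Comparable x y → y ∈⟨ z ⟩
      component {x} {z} x≢ε x∈ z-maximal = ⊆∧count≥⇒⊇ (_∈⟨ z ⟩?) (Comparable? x)
        (λ _ → chain z-maximal x∈)
        (≤-reflexive (trans (regular x≢ε) (sym (trans (ord≡count z) z-maximal))))

      meet : ∀ {w z z′} → w ≢ ε → w ∈⟨ z ⟩ → Maximal z → w ∈⟨ z′ ⟩ → Maximal z′ → ∀ {y} → y ∈⟨ z ⟩ → y ∈⟨ z′ ⟩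
      meet w≢ε w∈z z-maximal w∈z′ z′-maximal {y} y∈ = component w≢ε w∈z′ z′-maximal y (chain z-maximal w∈z y∈)

      -- The sequence of iterated `p`-th powers of `x` reaches `ε`; the witness is the last term
      -- before that.
      socle-element : ∀ {x} → x ≢ ε → ∃[ v ] (v ∈⟨ x ⟩ × v ≢ ε × v ^ p ≡ ε)
      socle-element {x} x≢ε = go a (subst (λ m → x ^ m ≡ ε) m≡pᵃ (exponent-suc-δ x))
        where
        go : ∀ b → x ^ (p ℕ.^ b) ≡ ε → ∃[ v ] (v ∈⟨ x ⟩ × v ≢ ε × v ^ p ≡ ε)
        go zero e = contradiction (trans (sym (^1 x)) e) x≢ε
        go (suc b) e with (x ^ (p ℕ.^ b)) ≟ ε
        ... | yes e′ = go b e′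
        ... | no ≢ε = x ^ (p ℕ.^ b) , ^-∈⟨⟩ (p ℕ.^ b) , ≢ε , trans (sym (^-* x p (p ℕ.^ b))) e

      S? : ∀ y → Dec (y ^ p ≢ ε)
      S? y = ¬? ((y ^ p) ≟ ε)

      S⇒≢ε : ∀ {y} → y ^ p ≢ ε → y ≢ ε
      S⇒≢ε y∈S refl = y∈S (ε^ p)

      -- An element c commuting with y yields v ∈⟨ c ⟩ of order p with (y v)ᵖ = yᵖ ≠ ε, so y v,
      -- y and hence v lie in one maximal cyclic subgroup.
      centralizer : ∀ {y z} → y ^ p ≢ ε → y ∈⟨ z ⟩ → Maximal z → ∀ c → Commute c y → c ∈⟨ z ⟩
      centralizer {y} {z} y∈S y∈ z-maximal c cy with c ≟ ε
      ... | yes refl = ε∈⟨⟩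
      ... | no c≢ε with socle-element c≢ε | maximal-cyclic c≢ε
      ...   | v , v∈@(k , v≡) , v≢ε , v^p | z″ , c∈ , z″-maximal =
        -- The maximal cyclic subgroup above `c` shares `v` with that of `z`, so it is contained in
        -- it.
        meet v≢ε (∈⟨⟩-trans v∈ c∈) z″-maximal v∈z z-maximal c∈
        where
        yv^p : (y ∙ v) ^ p ≡ y ^ p
        yv^p = trans (^-∙ (subst (Commute y) (sym v≡) (commute-^ (sym cy) k)) p)
          (trans (cong ((y ^ p) ∙_) v^p) (identityʳ _))
        v∈z : v ∈⟨ z ⟩
        v∈z with maximal-cyclic (λ e → S⇒≢ε (λ e′ → y∈S (trans (sym yv^p) e′)) e)
        ... | z′ , yv∈ , z′-maximal = ∙-cancelˡ-∈⟨⟩ y∈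
          (meet y∈S (subst (_∈⟨ z′ ⟩) yv^p (∈⟨⟩-trans (^-∈⟨⟩ p) yv∈)) z′-maximal
            (∈⟨⟩-trans (^-∈⟨⟩ p) y∈) z-maximal yv∈)

      class-size : ∀ {y} → y ^ p ≢ ε → |G| ≡ count (Conjugate? y) * suc δ
      class-size {y} y∈S with maximal-cyclic (S⇒≢ε y∈S)
      ... | z , y∈ , z-maximal = trans (orbit-stabilizer y) (cong (count (Conjugate? y) *_) (begin
        count (λ c → Commute? c y)  ≡⟨ count-cong (λ c → Commute? c y) (_∈⟨ z ⟩?)
                                         (centralizer y∈S y∈ z-maximal) (λ c c∈ → commute-∈⟨⟩ c∈ y∈) ⟩
        count (_∈⟨ z ⟩?)            ≡⟨ ord≡count z ⟩
        ord z                       ≡⟨ z-maximal ⟩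
        suc δ                       ∎))
        where open ≡-Reasoning

      -- The number `c` of elements of `S` in a maximal cyclic subgroup. Counting exponents makes it
      -- visibly independent of the generator.
      S-count : ℕ
      S-count = count {n = suc δ} (λ i → ¬? (suc δ ∣? p * toℕ i))

      count-S-cyclic : ∀ {z} → Maximal z → count (λ y → (y ∈⟨ z ⟩?) ×-dec S? y) ≡ S-count
      count-S-cyclic {z} z-maximal = begin
        count (λ y → (y ∈⟨ z ⟩?) ×-dec S? y)                     ≡⟨ count-∈⟨⟩ z S? ⟨
        count {n = ord z} (λ i → S? (z ^ toℕ i))                 ≡⟨ count-cong (λ (i : Fin (ord z)) → S? (z ^ toℕ i)) (λ i → ¬? (ord z ∣? p * toℕ i))
          (λ i ≢ε o∣ → ≢ε (trans (sym (^-* z p (toℕ i))) (∣⇒^≡ε z (^-ord z) o∣)))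
          (λ i o∤ e → o∤ (ord-∣ z (trans (^-* z p (toℕ i)) e))) ⟩
        -- The order is both the modulus and the size of the index set, so both occurrences change
        -- at once.
        count {n = ord z} (λ i → ¬? (ord z ∣? p * toℕ i))        ≡⟨ cong (λ m → count {n = m} (λ i → ¬? (m ∣? p * toℕ i))) z-maximal ⟩
        S-count                                                  ∎
        where open ≡-Reasoning

      exponent-p : ∀ y → y ^ p ≡ ε
      exponent-p y with (y ^ p) ≟ ε
      ... | yes e = e
      ... | no y∈S = contradiction |G|≡suc-δ (<⇒≢ δ<|G| ∘ sym)
        where
        k = count (Conjugate? y)
        -- Counted by rows and by columns, this relation yields `(|G| - 1) * S-count = |S| * δ`.
        T? : ∀ x y → Dec (x ≢ ε × y ^ p ≢ ε × Comparable x y)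
        T? x y = ¬? (x ≟ ε) ×-dec S? y ×-dec Comparable? x y

        rows : ∀ x → x ≢ ε → count (T? x) ≡ S-count
        rows x x≢ε with maximal-cyclic x≢ε
        ... | z , x∈ , z-maximal = trans
          (count-cong (T? x) (λ y → (y ∈⟨ z ⟩?) ×-dec S? y)
            (λ y (_ , y∈S , xy) → component x≢ε x∈ z-maximal y xy , y∈S)
            (λ y (y∈ , y∈S) → x≢ε , y∈S , chain z-maximal x∈ y∈))
          (count-S-cyclic z-maximal)

        columns : ∀ y → y ^ p ≢ ε → count (λ x → T? x y) ≡ δ
        columns y y∈S = suc-injective (trans (cong suc
            (count-cong (λ x → T? x y) (λ x → Comparable? y x ×-dec ¬? (ε ≟ x))
              (λ x (x≢ε , _ , xy) → swap xy , x≢ε ∘ sym)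
              (λ x (yx , ε≢x) → ε≢x ∘ sym , y∈S , swap yx)))
          (trans (sym (count-remove (Comparable? y) ε (inj₁ ε∈⟨⟩))) (regular (S⇒≢ε y∈S))))

        non-trivial? : ∀ x → Dec (x ≢ ε)
        non-trivial? x = ¬? (x ≟ ε)

        count-non-trivial : suc (count non-trivial?) ≡ |G|
        count-non-trivial = trans (cong suc (count-cong non-trivial? (λ x → yes tt ×-dec ¬? (ε ≟ x))
            (λ x x≢ε → tt , x≢ε ∘ sym) (λ x (_ , ε≢x) → ε≢x ∘ sym)))
          (trans (sym (count-remove {P = λ _ → ⊤} (λ (_ : Carrier) → yes tt) ε tt))
            (count-all {P = λ _ → ⊤} (λ (_ : Carrier) → yes tt) (λ _ → tt)))

        -- `S` is closed under conjugation, and by `class-size` all its classes have the size `k` of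
        -- the class of `y`.
        k∣S : k ∣ count S?
        k∣S = classes-∣ Conjugate? (λ x → ε , conj-ε x) Conjugate-euclidean k S?
          (λ { x _ x∈S (g , refl) e → x∈S (conj-injective g (trans (sym (conj-^ g x p))
            (trans e (sym (commute⇒conj-fixed (trans (identityʳ g) (sym (identityˡ g)))))))) })
          (λ x x∈S → *-cancelʳ-≡ _ k (suc δ) (trans (sym (class-size x∈S)) (class-size y∈S)))

        1≤S-count : 1 ≤ S-count
        1≤S-count = subst (1 ≤_) (rows y (S⇒≢ε y∈S))
          (count-pos (T? y) y (S⇒≢ε y∈S , y∈S , inj₁ ∈⟨⟩-refl))

        S-count≤δ : S-count ≤ δ
        S-count≤δ = subst (_≤ δ) (rows y (S⇒≢ε y∈S)) (≤-pred (begin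
          suc (count (T? y))                                             ≤⟨ s≤s (count-mono (T? y) (λ x → Comparable? y x ×-dec ¬? (ε ≟ x))
                                                                             (λ x (_ , x∈S , yx) → yx , S⇒≢ε x∈S ∘ sym)) ⟩
          suc (count (λ x → Comparable? y x ×-dec ¬? (ε ≟ x)))           ≡⟨ count-remove (Comparable? y) ε (inj₁ ε∈⟨⟩) ⟨
          count (Comparable? y)                                          ≡⟨ regular (S⇒≢ε y∈S) ⟩
          suc δ                                                          ∎))
          where open ≤-Reasoning

        k≡1 : k ≡ 1
        k≡1 = index-arithmetic
          (double-count non-trivial? S? T? S-count δ (λ x y (x≢ε , y∈S , _) → x≢ε , y∈S) rows columns)
          (trans count-non-trivial (class-size y∈S)) k∣S 1≤S-count S-count≤δ

        |G|≡suc-δ : |G| ≡ suc δ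
        |G|≡suc-δ = trans (class-size y∈S) (trans (cong (_* suc δ) k≡1) (*-identityˡ (suc δ)))

    prime-exponent : HasPrimeExponent G
    prime-exponent with factorise (suc δ)
    -- Without prime factors `suc δ` is 1, so `x₁ ^ 1 ≡ ε`.
    ... | record { factors = [] ; isFactorisation = m≡1 } =
      contradiction (trans (sym (^1 x₁)) (subst (λ m → x₁ ^ m ≡ ε) m≡1 (exponent-suc-δ x₁))) x₁≢ε
    ... | record { factors = p ∷ ps ; isFactorisation = m≡ ; factorsPrime = p-prime ∷ ps-prime }
      with All.all? (p ℕ.≟_) ps
    ...   | yes all≡ = p , p-prime , PrimePower.exponent-p p p-prime (suc (length ps))
              (trans m≡ (cong (p *_) (product-constant all≡)))
    ...   | no ¬all≡ = let q , q∈ , p≢q = find (¬All⇒Any¬ (p ℕ.≟_) ps ¬all≡) in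
      contradiction (subst (q ∣_) (sym m≡) (∣n⇒∣m*n p (∈⇒∣product q∈)))
        (prime-divisors-equal p-prime (All.lookup ps-prime q∈) (p≢q ∘ sym) (subst (p ∣_) (sym m≡) (m∣m*n (product ps))))

  -- Minimally edge-connected power graphs

  module Backward (non-complete : ¬ Complete Γ) (2≤|G| : 2 ≤ |G|)
    (critical : ∀ a b → Adj Γ a b → ∀ k → EdgeConnectivity Γ k → EdgeConnectivity (deleteEdge Γ a b) (k ∸ 1)) where

    minimum-degree : ∃[ d ] ((∃[ x ] degree x ≡ d) × ∀ k → (∃[ x ] degree x ≡ k) → d ≤ k)
    minimum-degree = least (λ d → any? (λ x → degree x ℕ.≟ d)) (degree ε) (ε , refl)

    δ : ℕ
    δ = proj₁ minimum-degree

    δ≤degree : ∀ x → δ ≤ degree x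
    δ≤degree x = proj₂ (proj₂ minimum-degree) (degree x) (x , refl)

    has-neighbour : ∀ x → 1 ≤ degree x
    has-neighbour x with x ≟ ε
    ... | no x≢ε = count-pos (adj? x) ε (ε-dominating x x≢ε)
    ... | yes refl = ≤-pred (≤-trans 2≤|G| (≤-reflexive (sym degree-ε)))

    -- Ensures that the truncated difference `δ ∸ 1` really is smaller than `δ`.
    1≤δ : 1 ≤ δ
    1≤δ = let x , e = proj₁ (proj₂ minimum-degree) in subst (1 ≤_) e (has-neighbour x)

    -- Otherwise every closed neighbourhood would be as large as that of `ε`, which is all of `G`,
    -- and the graph would be complete.
    δ<degree-ε : δ < degree ε
    δ<degree-ε = ≰⇒> λ degree-ε≤δ → non-complete λ x y x≢y → comparable⇒adjacent x≢y
      (⊆∧count≥⇒⊇ (Comparable? x) (Comparable? ε) (λ _ _ → inj₂ ε∈⟨⟩)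
        (≤-trans (≤-reflexive (count-Comparable ε)) (≤-trans (s≤s (≤-trans degree-ε≤δ (δ≤degree x)))
          (≤-reflexive (sym (count-Comparable x)))))
        y (inj₂ ε∈⟨⟩))

    -- Isolating a vertex of minimum degree attains the bound that `disconnecting-≥` gives for the
    -- dominating vertex `ε`.
    edge-connectivity : EdgeConnectivity Γ δ
    edge-connectivity =
      let x , degree≡δ = proj₁ (proj₂ minimum-degree)
          y , x≢y = distinct-from 2≤|G| x
          F , length-F , disconnecting = isolating-set Γ adj? x≢y
      in inj₂ (2≤|G| , (F , trans length-F degree≡δ , disconnecting) ,
           disconnecting-≥ Γ adj? ε ε δ (λ v v≢ε _ → ε-dominating v v≢ε) δ≤degree)

    -- Otherwise deleting the edge {x, ε} would keep all degrees at least δ, and hence the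
    -- edge-connectivity.
    degree≡δ : ∀ {x} → x ≢ ε → degree x ≡ δ
    degree≡δ {x} x≢ε = ≤-antisym (≮⇒≥ λ δ<degree → too-small δ<degree
      (critical x ε (ε-dominating x x≢ε) δ edge-connectivity)) (δ≤degree x)
      where
      module _ (δ<degree : δ < degree x) where
        -- Without the edge to `ε`, `x` becomes the exceptional vertex `w` of `disconnecting-≥`.
        dominating : ∀ v → v ≢ ε → v ≢ x → Adj (deleteEdge Γ x ε) v ε
        dominating v v≢ε v≢x = ε-dominating v v≢ε ,
          (λ { (here refl) → v≢x refl }) , (λ { (here refl) → v≢ε refl })
        too-small : ¬ EdgeConnectivity (deleteEdge Γ x ε) (δ ∸ 1)
        too-small (inj₁ (V<2 , _)) = <⇒≱ V<2 2≤|G|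
        too-small (inj₂ (_ , (F , length-F , disconnecting) , _)) = <⇒≱ (∸-monoʳ-< {δ} (s≤s z≤n) 1≤δ)
          (subst (δ ≤_) length-F (disconnecting-≥ (deleteEdge Γ x ε) (deleteEdge-adj? Γ adj? x ε) ε x δ
            dominating (deleteEdge-degree-≥ Γ adj? x ε δ δ≤degree δ<degree δ<degree-ε) F disconnecting))

    conclusion : (¬ IsCyclic G) × HasPrimeExponent G
    conclusion =
      let x , ε≢x = distinct-from 2≤|G| ε
          open Regular δ (subst (suc δ <_) degree-ε (s≤s δ<degree-ε)) x (ε≢x ∘ sym)
            (λ x≢ε → trans (count-Comparable _) (cong suc (degree≡δ x≢ε)))
      in non-cyclic , prime-exponent

theorem1p1 : (G : FiniteGroup) →
    ((¬ IsCyclic G) × HasPrimeExponent G) ⇔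
    ((¬ Complete (powerGraph G)) × MinimallyEdgeConnected (powerGraph G))
theorem1p1 G = mk⇔
  (λ (¬cyclic , p , pr , exponent-p) →
    Forward.non-complete ¬cyclic p pr exponent-p , Forward.minimally ¬cyclic p pr exponent-p)
  (λ (non-complete , 2≤|G| , _ , critical) → Backward.conclusion non-complete 2≤|G| critical)
  where open PowerGraph G
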